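{- Let $G$ be a $5$-regular graph that has no $(4,1)$-coloring, and which is vertex-minimal with this property (every $5$-regular graph with fewer vertices than $G$ has a $(4,1)$-coloring). Then: (a) $G$ is connected. (b) $G$ is not $4$-edge-connected, i.e., $G$ contains an edge cut on $3$ edges. (c) $G$ has no minimal edge cut of size $2$. (d) $G$ does not have two bridges. (e) Each bridge in $G$ has precisely one endpoint incident to two loops. (f) The edges of any minimal edge cut of size $3$ in $G$ have a vertex in common, and this vertex is incident to a loop.
   Context: All graphs are finite, undirected pseudographs (multiple edges and loops allowed; a loop contributes $2$ to the degree). A $(4,1)$-coloring of a $5$-regular graph is an edge-coloring using at least two colors such that every vertex is incident to exactly $4$ edges of one color and exactly $1$ edge of a different color. A set $S$ of edges of a connected graph $G$ is an edge cut if $G-S$ is disconnected; it is minimal if $G-(S\setminus\{e\})$ is connected for every $e\in S$. A bridge is an edge cut of size $1$. -}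

module Defs where

open import Data.Nat using (ℕ; zero; suc; _+_; _<_; _≤_)
open import Data.Fin using (Fin; zero; suc; _≟_)
open import Data.Fin.Subset using (Subset; _∈_; _∉_; ∣_∣; outside) renaming (⊥ to ∅)
open import Data.Vec using (_[_]≔_)
open import Data.Product using (_×_; _,_; proj₁; proj₂; Σ; ∃)
open import Data.Sum using (_⊎_)
open import Relation.Nullary using (¬_; yes; no)
open import Relation.Binary.PropositionalEquality using (_≡_; _≢_)

-- A finite pseudograph: vertices Fin n, edges Fin m, each edge has two
-- endpoints (equal endpoints = loop).  Multiple edges are allowed.
record Graph (n m : ℕ) : Set where
  field
    ends : Fin m → Fin n × Fin n

open Graph public

sumFin : ∀ {m} → (Fin m → ℕ) → ℕ
sumFin {zero} f = 0
sumFin {suc m} f = f zero + sumFin (λ i → f (suc i))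

-- multiplicity of vertex v as an endpoint of edge e (a loop at v gives 2)
mult : ∀ {n} → Fin n → Fin n × Fin n → ℕ
mult v (a , b) = ind a + ind b
  where
  ind : _ → ℕ
  ind x with x ≟ v
  ... | yes _ = 1
  ... | no _ = 0

degree : ∀ {n m} → Graph n m → Fin n → ℕ
degree G v = sumFin (λ e → mult v (ends G e))

colDegree : ∀ {n m} → Graph n m → (Fin m → ℕ) → ℕ → Fin n → ℕ
colDegree {m = m} G c a v = sumFin (λ e → sel e)
  where
  sel : Fin m → ℕ
  sel e with Data.Nat._≟_ (c e) a
  ... | yes _ = mult v (ends G e)
  ... | no _ = 0

Regular : ∀ {n m} → ℕ → Graph n m → Set
Regular k G = ∀ v → degree G v ≡ k

Is41Coloring : ∀ {n m} → Graph n m → (Fin m → ℕ) → Set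
Is41Coloring {m = m} G c =
  (Σ (Fin m) λ e → Σ (Fin m) λ e' → c e ≢ c e')
  × (∀ v → Σ ℕ λ a → Σ ℕ λ b → a ≢ b × colDegree G c a v ≡ 4 × colDegree G c b v ≡ 1)

Has41Coloring : ∀ {n m} → Graph n m → Set
Has41Coloring {m = m} G = Σ (Fin m → ℕ) λ c → Is41Coloring G c

Joins : ∀ {n m} → Graph n m → Fin m → Fin n → Fin n → Set
Joins G e u v = ends G e ≡ (u , v) ⊎ ends G e ≡ (v , u)

data Reach {n m} (G : Graph n m) (S : Subset m) : Fin n → Fin n → Set where
  here : ∀ {v} → Reach G S v v
  step : ∀ {u v w} (e : Fin m) → e ∉ S → Joins G e u v → Reach G S v w → Reach G S u w

ConnectedMinus : ∀ {n m} → Graph n m → Subset m → Set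
ConnectedMinus G S = ∀ u v → Reach G S u v

Connected : ∀ {n m} → Graph n m → Set
Connected G = ConnectedMinus G ∅

EdgeCut : ∀ {n m} → Graph n m → Subset m → Set
EdgeCut G S = ¬ ConnectedMinus G S

MinimalEdgeCut : ∀ {n m} → Graph n m → Subset m → Set
MinimalEdgeCut G S = EdgeCut G S × (∀ e → e ∈ S → ConnectedMinus G (S [ e ]≔ outside))

Bridge : ∀ {n m} → Graph n m → Fin m → Set
Bridge G e = Σ (Subset _) λ S → EdgeCut G S × ∣ S ∣ ≡ 1 × e ∈ S

loops : ∀ {n m} → Graph n m → Fin n → ℕ
loops {m = m} G v = sumFin isLoop
  where
  isLoop : Fin m → ℕ
  isLoop e with proj₁ (ends G e) ≟ v | proj₂ (ends G e) ≟ v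
  ... | yes _ | yes _ = 1
  ... | _ | _ = 0

EndOf : ∀ {n m} → Graph n m → Fin m → Fin n → Set
EndOf G e v = proj₁ (ends G e) ≡ v ⊎ proj₂ (ends G e) ≡ v

-- G is a vertex-minimal 5-regular graph without (4,1)-colouring
-- (graphs are nonempty: at least one vertex)
MinimalCounterexample : ∀ {n m} → Graph n m → Set
MinimalCounterexample {n} G =
  1 ≤ n × Regular 5 G × ¬ Has41Coloring G
  × (∀ n' m' (H : Graph n' m') → 1 ≤ n' → n' < n → Regular 5 H → Has41Coloring H)

{-# OPTIONS --safe #-}
module Submission where

-- Colourings of the two sides of a small cut can be glued once their colours on the cut edges agree, and
-- colour names are irrelevant, so only the equality pattern on the cut matters.  A side of the cut is
-- coloured by minimality after replacing the other side: for a cut of size 0 by nothing, for a bridge by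
-- a vertex with two loops, for a cut of size 2 by a single edge.  For a cut of size 3, a vertex with one
-- loop yields some pattern in which exactly two edges agree; joining two of the edges and ending the
-- third in a vertex with two loops yields, for each pair, the pattern where just that pair agrees or the
-- constant one.  Hence either both sides have the constant pattern, or one side has all three
-- two-equal patterns and the other side has one of them.
--
-- For (b), a perfect matching is a (4,1)-colouring.  In a 5-regular graph an odd set of vertices has an odd
-- cut, so if no cut has size 1 or 3 all odd cuts have size at least 5, and Tutte's theorem applies.
-- Its proof deletes vertices covered by all maximum matchings until no such vertex is left; by Gallai's
-- lemma "no maximum matching misses both" is then an equivalence relation whose classes are unions of
-- components.  There are more odd classes than deleted vertices, although each sends at least 5 edges to
-- the deleted set, whose vertices have degree 5.

open import Defs
open import Data.Nat using (ℕ; zero; suc; _+_; _*_; _≤_; _<_; z≤n; s≤s; _≤?_)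
import Data.Nat as ℕ
open import Data.Nat.Properties hiding (_≟_; <-cmp; _<?_; _≤?_)
open import Data.Nat.Tactic.RingSolver using (solve-∀)
open import Data.Fin using (Fin; zero; suc; _≟_; _<?_; splitAt; join)
open import Data.Fin.Properties using (any?; <-cmp; join-splitAt)
open import Data.Fin.Subset using (Subset; _∈_; ∣_∣; outside) renaming (⊥ to ∅)
open import Data.Fin.Subset.Properties using (anySubset?; ∣p∣≤n; ∉⊥)
open import Data.Vec using ([]; _∷_; lookup; tabulate; _[_]≔_)
open import Data.Vec.Properties using ([]=⇒lookup; lookup⇒[]=; lookup∘update′; lookup∘tabulate)
open import Data.Bool using (Bool; true; false; not; _∧_; _∨_; _xor_; if_then_else_)
import Data.Bool as Bool
open import Data.Bool.Properties using (∨-comm; ∨-zeroʳ; not-involutive; xor-same; xor-identityʳ)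
open import Data.Maybe using (Maybe; just; nothing; maybe′; is-nothing)
open import Data.Product using (_×_; _,_; proj₁; proj₂; Σ)
open import Data.Sum using (_⊎_; inj₁; inj₂; map₁; swap)
open import Data.Empty using (⊥; ⊥-elim)
open import Relation.Nullary using (¬_; Dec; yes; no; does; ¬?)
open import Relation.Nullary.Decidable using (dec-true; dec-false; does-⇔; _×-dec_; _⊎-dec_; ¬¬-excluded-middle)
open import Relation.Binary using (tri<; tri≈; tri>)
open import Relation.Binary.PropositionalEquality
open import Function using (_∘_; id; mk⇔)

-- Indicators and Boolean facts

⟦_⟧ : Bool → ℕ
⟦ true ⟧ = 1
⟦ false ⟧ = 0

infix 7 _==_
_==_ : ∀ {n} → Fin n → Fin n → Bool
u == v = does (u ≟ v)

==-refl : ∀ {n} (v : Fin n) → (v == v) ≡ true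
==-refl v = dec-true (v ≟ v) refl

==-sound : ∀ {n} {u v : Fin n} → (u == v) ≡ true → u ≡ v
==-sound {u = u} {v} p with u ≟ v
... | yes q = q

==-sym : ∀ {n} (u v : Fin n) → (u == v) ≡ (v == u)
==-sym u v = does-⇔ (mk⇔ sym sym) (u ≟ v) (v ≟ u)

true≢false : ∀ {b} → b ≡ true → b ≡ false → ⊥
true≢false refl ()

∨-split : ∀ {a b} → (a ∨ b) ≡ true → a ≡ true ⊎ b ≡ true
∨-split {true} _ = inj₁ refl
∨-split {false} p = inj₂ p

not-true : ∀ {b} → not b ≡ true → b ≡ false
not-true {false} _ = refl

xor-split : ∀ {a b} → (a xor b) ≡ true → (a ≡ true × b ≡ false) ⊎ (a ≡ false × b ≡ true)
xor-split {true} p = inj₁ (refl , not-true p)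
xor-split {false} p = inj₂ (refl , p)

not-xor-not : ∀ a b → (not a xor not b) ≡ (a xor b)
not-xor-not true true = refl
not-xor-not true false = refl
not-xor-not false true = refl
not-xor-not false false = refl

-- Finite sums

sum-cong : ∀ {m} {f g : Fin m → ℕ} → (∀ i → f i ≡ g i) → sumFin f ≡ sumFin g
sum-cong {zero} h = refl
sum-cong {suc m} h = cong₂ _+_ (h zero) (sum-cong (h ∘ suc))

sum-+ : ∀ {m} (f g : Fin m → ℕ) → sumFin (λ i → f i + g i) ≡ sumFin f + sumFin g
sum-+ {zero} f g = refl
sum-+ {suc m} f g rewrite sum-+ (f ∘ suc) (g ∘ suc) =
  shuffle (f zero) (g zero) (sumFin (f ∘ suc)) (sumFin (g ∘ suc))
  where
  shuffle : ∀ a b c d → a + b + (c + d) ≡ a + c + (b + d)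
  shuffle = solve-∀

sum-*ˡ : ∀ {m} k (f : Fin m → ℕ) → sumFin (λ i → k * f i) ≡ k * sumFin f
sum-*ˡ {zero} k f = sym (*-zeroʳ k)
sum-*ˡ {suc m} k f rewrite sum-*ˡ k (f ∘ suc) = sym (*-distribˡ-+ k (f zero) _)

sum-0 : ∀ m → sumFin {m} (λ _ → 0) ≡ 0
sum-0 zero = refl
sum-0 (suc m) = sum-0 m

sum-1 : ∀ m → sumFin {m} (λ _ → 1) ≡ m
sum-1 zero = refl
sum-1 (suc m) = cong suc (sum-1 m)

sum-mono : ∀ {m} {f g : Fin m → ℕ} → (∀ i → f i ≤ g i) → sumFin f ≤ sumFin g
sum-mono {zero} h = z≤n
sum-mono {suc m} h = +-mono-≤ (h zero) (sum-mono (h ∘ suc))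

term≤sum : ∀ {m} (f : Fin m → ℕ) i → f i ≤ sumFin f
term≤sum f zero = m≤m+n _ _
term≤sum f (suc i) = ≤-trans (term≤sum (f ∘ suc) i) (m≤n+m _ _)

sum-swap : ∀ {m k} (f : Fin m → Fin k → ℕ) →
  sumFin (λ i → sumFin (f i)) ≡ sumFin (λ j → sumFin (λ i → f i j))
sum-swap {zero} {k} f = sym (sum-0 k)
sum-swap {suc m} f rewrite sum-swap (f ∘ suc) = sym (sum-+ (f zero) _)

sum-δ : ∀ {m} j (g : Fin m → ℕ) → sumFin (λ i → ⟦ i == j ⟧ * g i) ≡ g j
sum-δ {suc m} zero g rewrite sum-0 m = trans (+-identityʳ _) (+-identityʳ _)
sum-δ {suc m} (suc j) g = sum-δ j (g ∘ suc)

sum-δ-1 : ∀ {m} (j : Fin m) → sumFin (λ i → ⟦ i == j ⟧) ≡ 1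
sum-δ-1 {m} j = trans (sum-cong λ (i : Fin m) → sym (*-identityʳ _)) (sum-δ j (λ _ → 1))

sum-splitAt : ∀ l {m} (h : Fin l ⊎ Fin m → ℕ) →
  sumFin (λ i → h (splitAt l i)) ≡ sumFin (h ∘ inj₁) + sumFin (h ∘ inj₂)
sum-splitAt zero h = refl
sum-splitAt (suc l) {m} h = trans (cong (h (inj₁ zero) +_) tail) (sym (+-assoc (h (inj₁ zero)) _ _))
  where
  h′ : Fin l ⊎ Fin m → ℕ
  h′ = h ∘ map₁ suc
  tail : sumFin (λ i → h (splitAt (suc l) (suc i))) ≡ sumFin (h ∘ inj₁ ∘ suc) + sumFin (h ∘ inj₂)
  tail = sum-splitAt l h′

count : ∀ {m} → (Fin m → Bool) → ℕ
count q = sumFin (λ e → ⟦ q e ⟧)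

⟦⟧≤1 : ∀ b → ⟦ b ⟧ ≤ 1
⟦⟧≤1 true = s≤s z≤n
⟦⟧≤1 false = z≤n

count<size : ∀ {m} (q : Fin m → Bool) z → q z ≡ false → count q < m
count<size {m} q z qz = begin-strict
  count q                                 <⟨ n<1+n _ ⟩
  suc (count q)                           ≡⟨ +-comm 1 (count q) ⟩
  count q + 1                             ≡⟨ cong (count q +_) (sum-δ-1 z) ⟨
  count q + sumFin (λ i → ⟦ i == z ⟧)     ≡⟨ sum-+ (λ i → ⟦ q i ⟧) (λ i → ⟦ i == z ⟧) ⟨
  sumFin (λ i → ⟦ q i ⟧ + ⟦ i == z ⟧)     ≤⟨ sum-mono bound ⟩
  sumFin {m} (λ _ → 1)                    ≡⟨ sum-1 m ⟩
  m ∎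
  where
  open ≤-Reasoning
  bound : ∀ i → ⟦ q i ⟧ + ⟦ i == z ⟧ ≤ 1
  bound i with i ≟ z
  ... | yes refl rewrite qz = ≤-refl
  ... | no _ rewrite +-identityʳ ⟦ q i ⟧ = ⟦⟧≤1 (q i)

-- Enumerating a decidable subset of Fin m

-- `extend` carries a function on indices back to `Fin m`, with a default off the subset. Applied to
-- `id` it is a left inverse of `elem`, which yields injectivity.
record Enum {m} (q : Fin m → Bool) (k : ℕ) : Set₁ where
  field
    elem : Fin k → Fin m
    elem-sound : ∀ j → q (elem j) ≡ true
    elem-complete : ∀ e → q e ≡ true → Σ (Fin k) λ j → elem j ≡ e
    sum-elem : ∀ g → sumFin (λ e → ⟦ q e ⟧ * g e) ≡ sumFin (g ∘ elem)
    extend : {A : Set} → A → (Fin k → A) → Fin m → A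
    extend-elem : ∀ {A} (d : A) f j → extend d f (elem j) ≡ f j

  elem-injective : ∀ {i j} → elem i ≡ elem j → i ≡ j
  elem-injective {i} {j} p =
    trans (sym (extend-elem i id i)) (trans (cong (extend i id) p) (extend-elem i id j))

  count≡size : count q ≡ k
  count≡size =
    trans (sum-cong λ (e : Fin m) → sym (*-identityʳ _)) (trans (sum-elem (λ _ → 1)) (sum-1 k))

enum : ∀ {m} (q : Fin m → Bool) → Σ ℕ (Enum q)
enum {zero} q = 0 , record
  { elem = λ () ; elem-sound = λ () ; elem-complete = λ () ; sum-elem = λ _ → refl
  ; extend = λ d _ _ → d ; extend-elem = λ _ _ () }
enum {suc m} q with enum (q ∘ suc) | q zero in q0
... | k , E | true = suc k , record
  { elem = λ { zero → zero ; (suc j) → suc (elem j) }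
  ; elem-sound = λ { zero → q0 ; (suc j) → elem-sound j }
  ; elem-complete = λ { zero _ → zero , refl
                      ; (suc e) p → suc (proj₁ (elem-complete e p)) , cong suc (proj₂ (elem-complete e p)) }
  ; sum-elem = λ g → cong₂ _+_ (trans (cong (λ b → ⟦ b ⟧ * g zero) q0) (*-identityˡ _)) (sum-elem (g ∘ suc))
  ; extend = λ { d f zero → f zero ; d f (suc e) → extend d (f ∘ suc) e }
  ; extend-elem = λ { d f zero → refl ; d f (suc j) → extend-elem d (f ∘ suc) j }
  } where open Enum E
... | k , E | false = k , record
  { elem = suc ∘ elem
  ; elem-sound = elem-sound
  ; elem-complete = λ { zero p → ⊥-elim (true≢false p q0)
                      ; (suc e) p → proj₁ (elem-complete e p) , cong suc (proj₂ (elem-complete e p)) }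
  ; sum-elem = λ g → trans (cong (λ b → ⟦ b ⟧ * g zero + sumFin (λ e → ⟦ q (suc e) ⟧ * g (suc e))) q0) (sum-elem (g ∘ suc))
  ; extend = λ { d f zero → d ; d f (suc e) → extend d f e }
  ; extend-elem = λ d f j → extend-elem d f j
  } where open Enum E

-- With `count q` as the length, a known size of a cut can be substituted to list its edges
-- explicitly.
enum-count : ∀ {m} (q : Fin m → Bool) → Enum q (count q)
enum-count q = subst (Enum q) (sym (Enum.count≡size (proj₂ (enum q)))) (proj₂ (enum q))

-- Weighted degrees

mult-ind : ∀ {n} (v a b : Fin n) → mult v (a , b) ≡ ⟦ a == v ⟧ + ⟦ b == v ⟧
mult-ind v a b with a ≟ v | b ≟ v
... | yes _ | yes _ = refl
... | yes _ | no _ = refl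
... | no _ | yes _ = refl
... | no _ | no _ = refl

mult-cong : ∀ {n n′} (v a b : Fin n) (v′ a′ b′ : Fin n′) →
  (a == v) ≡ (a′ == v′) → (b == v) ≡ (b′ == v′) → mult v (a , b) ≡ mult v′ (a′ , b′)
mult-cong v a b v′ a′ b′ p q =
  trans (mult-ind v a b) (trans (cong₂ (λ s t → ⟦ s ⟧ + ⟦ t ⟧) p q) (sym (mult-ind v′ a′ b′)))

-- Weight 1 gives the degree, `is a ∘ c` the degree in colour `a`, and a factor `⟦ Q e ⟧` restricts
-- to a subgraph, so one computation serves regularity and colourings alike.
wdeg : ∀ {n m} → Graph n m → (Fin m → ℕ) → Fin n → ℕ
wdeg G w v = sumFin (λ e → w e * mult v (ends G e))

degree≡wdeg : ∀ {n m} (G : Graph n m) v → degree G v ≡ wdeg G (λ _ → 1) v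
degree≡wdeg {m = m} G v = sum-cong λ (e : Fin m) → sym (*-identityˡ _)

is : ℕ → ℕ → ℕ
is a x with x ℕ.≟ a
... | yes _ = 1
... | no _ = 0

-- The summands of colDegree and loops are where-local functions; the mutual
-- blocks let the first equation determine their type in the second.
mutual
  colDegree≡wdeg : ∀ {n m} (G : Graph n m) c a v → colDegree G c a v ≡ wdeg G (is a ∘ c) v
  colDegree≡wdeg G c a v = sum-cong (colDegree-summand G c a v)

  colDegree-summand : ∀ {n m} (G : Graph n m) c a v e → _ ≡ is a (c e) * mult v (ends G e)
  colDegree-summand G c a v e with c e ℕ.≟ a
  ... | yes _ = sym (*-identityˡ _)
  ... | no _ = refl

mutual
  loops≡sum : ∀ {n m} (G : Graph n m) v →
    loops G v ≡ sumFin (λ e → ⟦ proj₁ (ends G e) == v ∧ proj₂ (ends G e) == v ⟧)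
  loops≡sum G v = sum-cong (loops-summand G v)

  loops-summand : ∀ {n m} (G : Graph n m) v e →
    _ ≡ ⟦ proj₁ (ends G e) == v ∧ proj₂ (ends G e) == v ⟧
  loops-summand G v e with proj₁ (ends G e) ≟ v | proj₂ (ends G e) ≟ v
  ... | yes _ | yes _ = refl
  ... | yes _ | no _ = refl
  ... | no _ | yes _ = refl
  ... | no _ | no _ = refl

-- The (4,1) condition at single vertices

Good : (ℕ → ℕ) → Set
Good d = Σ ℕ λ a → Σ ℕ λ b → a ≢ b × d a ≡ 4 × d b ≡ 1

good-cong : ∀ {d d′} → (∀ a → d a ≡ d′ a) → Good d → Good d′
good-cong h (a , b , a≢b , p , q) = a , b , a≢b , trans (sym (h a)) p , trans (sym (h b)) q

GoodAt : ∀ {n m} → Graph n m → (Fin m → ℕ) → Fin n → Set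
GoodAt G c v = Good (λ a → wdeg G (is a ∘ c) v)

GoodOn : ∀ {n m} → Graph n m → (Fin n → Bool) → (Fin m → ℕ) → Set
GoodOn G X c = ∀ v → X v ≡ true → GoodAt G c v

nonzero-term : ∀ {m} (f : Fin m → ℕ) {k} → sumFin f ≡ suc k → Σ (Fin m) λ i → f i ≢ 0
nonzero-term {suc m} f p with f zero in f0
... | suc j = zero , λ q → 1+n≢0 (trans (sym f0) q)
... | zero with nonzero-term (f ∘ suc) p
...   | i , q = suc i , q

is-sound : ∀ {a x} → is a x ≢ 0 → x ≡ a
is-sound {a} {x} p with x ℕ.≟ a
... | yes q = q
... | no _ = ⊥-elim (p refl)

colour-occurs : ∀ {n m} (G : Graph n m) c a v {k} → wdeg G (is a ∘ c) v ≡ suc k → Σ (Fin m) λ e → c e ≡ a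
colour-occurs {m = m} G c a v p with nonzero-term {m} _ p
... | e , q = e , is-sound λ z → q (cong (_* mult v (ends G e)) z)

-- Two colours occur because both colours demanded at vertex `zero` have positive degree there.
has-colouring : ∀ {n m} (G : Graph n m) → 1 ≤ n → ∀ c → (∀ v → GoodAt G c v) → Has41Coloring G
has-colouring {suc n} G _ c good with good zero
... | a , b , a≢b , p , q with colour-occurs G c a zero p | colour-occurs G c b zero q
...   | e , ce | e′ , ce′ = c , (e , e′ , λ r → a≢b (trans (sym ce) (trans r ce′))) ,
        λ v → good-cong (λ a → sym (colDegree≡wdeg G c a v)) (good v)

-- Colouring a smaller subgraph by minimality

Smaller : ℕ → Set
Smaller n = ∀ n′ m′ (H : Graph n′ m′) → 1 ≤ n′ → n′ < n → Regular 5 H → Has41Coloring H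

src tgt : ∀ {n m} → Graph n m → Fin m → Fin n
src G e = proj₁ (ends G e)
tgt G e = proj₂ (ends G e)

-- The subgraph with vertices `P` and edges `Q` is renumbered so that minimality applies, and its
-- colouring is carried back to `H`. The vertex `x` makes it nonempty, and `z` makes it strictly
-- smaller.
module _ {n k} (H : Graph n k) (smaller : Smaller n) (P : Fin n → Bool) (Q : Fin k → Bool)
  (Q⊆P : ∀ e → Q e ≡ true → P (src H e) ≡ true × P (tgt H e) ≡ true)
  (regular : ∀ v → P v ≡ true → wdeg H (λ e → ⟦ Q e ⟧ * 1) v ≡ 5)
  (x : Fin n) (Px : P x ≡ true) (z : Fin n) (Pz : P z ≡ false)
  {kP kQ} (VE : Enum P kP) (EE : Enum Q kQ) where

  private
    module VE = Enum VE
    module EE = Enum EE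

    j₀ : Fin kP
    j₀ = proj₁ (VE.elem-complete x Px)

    -- The default `j₀` is never seen: only ends of edges in `Q` are renumbered, and these lie in
    -- `P`.
    idx : Fin n → Fin kP
    idx = VE.extend j₀ id

    idx-== : ∀ a j → P a ≡ true → (idx a == j) ≡ (a == VE.elem j)
    idx-== a j Pa with VE.elem-complete a Pa
    ... | i , refl = does-⇔ (mk⇔ (λ p → cong VE.elem (trans (sym (VE.extend-elem j₀ id i)) p))
                                 (λ p → trans (VE.extend-elem j₀ id i) (VE.elem-injective p)))
                            (idx (VE.elem i) ≟ j) (VE.elem i ≟ VE.elem j)

    H′ : Graph kP kQ
    H′ = record { ends = λ j → idx (src H (EE.elem j)) , idx (tgt H (EE.elem j)) }

    mult-idx : ∀ i j → mult j (ends H′ i) ≡ mult (VE.elem j) (ends H (EE.elem i))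
    mult-idx i j with Q⊆P (EE.elem i) (EE.elem-sound i)
    ... | Pa , Pb = mult-cong j (idx a) (idx b) (VE.elem j) a b (idx-== a j Pa) (idx-== b j Pb)
      where
      a = src H (EE.elem i)
      b = tgt H (EE.elem i)

    wdeg-H′ : ∀ w j → wdeg H′ (w ∘ EE.elem) j ≡ wdeg H (λ e → ⟦ Q e ⟧ * w e) (VE.elem j)
    wdeg-H′ w j = begin
      sumFin (λ i → w (EE.elem i) * mult j (ends H′ i))
        ≡⟨ (sum-cong λ (i : Fin kQ) → cong (w (EE.elem i) *_) (mult-idx i j)) ⟩
      sumFin (λ i → w (EE.elem i) * mult (VE.elem j) (ends H (EE.elem i)))
        ≡⟨ EE.sum-elem (λ e → w e * mult (VE.elem j) (ends H e)) ⟨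
      sumFin (λ e → ⟦ Q e ⟧ * (w e * mult (VE.elem j) (ends H e)))
        ≡⟨ (sum-cong λ (e : Fin k) → sym (*-assoc ⟦ Q e ⟧ (w e) _)) ⟩
      wdeg H (λ e → ⟦ Q e ⟧ * w e) (VE.elem j) ∎
      where open ≡-Reasoning

    coloured : Has41Coloring H′
    coloured = smaller _ _ H′ (nonempty j₀) (subst (_< n) VE.count≡size (count<size P z Pz)) λ j →
      trans (degree≡wdeg H′ j) (trans (wdeg-H′ (λ _ → 1) j) (regular (VE.elem j) (VE.elem-sound j)))
      where
      nonempty : ∀ {k} → Fin k → 1 ≤ k
      nonempty {suc k} _ = s≤s z≤n

  subgraph-coloured : Σ (Fin k → ℕ) λ c →
    ∀ v → P v ≡ true → Good (λ a → wdeg H (λ e → ⟦ Q e ⟧ * is a (c e)) v)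
  subgraph-coloured = c , good
    where
    c′ = proj₁ coloured
    c : Fin k → ℕ
    -- The default colour 0 on edges outside `Q` is cancelled by the factor `⟦ Q e ⟧`.
    c = EE.extend 0 c′
    good : ∀ v → P v ≡ true → Good (λ a → wdeg H (λ e → ⟦ Q e ⟧ * is a (c e)) v)
    good v Pv = subst (λ u → Good (λ a → wdeg H (λ e → ⟦ Q e ⟧ * is a (c e)) u))
      (proj₂ (VE.elem-complete v Pv)) (good-cong same (proj₂ (proj₂ coloured) j))
      where
      j = proj₁ (VE.elem-complete v Pv)
      same : ∀ a → colDegree H′ c′ a j ≡ wdeg H (λ e → ⟦ Q e ⟧ * is a (c e)) (VE.elem j)
      same a = trans (colDegree≡wdeg H′ c′ a j) (trans
        (sum-cong λ (i : Fin kQ) →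
          cong (λ t → is a t * mult j (ends H′ i)) (sym (EE.extend-elem 0 c′ i)))
        (wdeg-H′ (is a ∘ c) j))

-- Edge cuts

cross touch : ∀ {n m} → Graph n m → (Fin n → Bool) → Fin m → Bool
cross G X e = X (src G e) xor X (tgt G e)
touch G X e = X (src G e) ∨ X (tgt G e)

==-false : ∀ {n} (X : Fin n → Bool) {u v} → X u ≡ false → X v ≡ true → (u == v) ≡ false
==-false X {u} {v} Xu Xv = dec-false (u ≟ v) λ { refl → true≢false Xv Xu }

mult-outside : ∀ {n} (X : Fin n → Bool) {v a b} → X v ≡ true → X a ≡ false → X b ≡ false → mult v (a , b) ≡ 0
mult-outside X {v} {a} {b} Xv Xa Xb =
  trans (mult-ind v a b) (cong₂ (λ s t → ⟦ s ⟧ + ⟦ t ⟧) (==-false X Xa Xv) (==-false X Xb Xv))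

-- Contract the complement of X to y, drop the edges e with τ e = just b, and add the edges B.  A colouring
-- of the result is pulled back to the edges of G meeting X, a dropped edge taking the colour of B b.
module Replace {n m} (G : Graph n m) (smaller : Smaller n) (reg : Regular 5 G) (X : Fin n → Bool)
  {l} (B : Fin l → Fin n × Fin n) (τ : Fin m → Maybe (Fin l)) (P : Fin n → Bool)
  (y : Fin n) (Xy : X y ≡ false)
  (X⊆P : ∀ v → X v ≡ true → P v ≡ true)
  (P⊆X+y : ∀ v → P v ≡ true → X v ≡ true ⊎ v ≡ y)
  (B⊆P : ∀ b → P (proj₁ (B b)) ≡ true × P (proj₂ (B b)) ≡ true)
  (kept⇒y∈P : ∀ e → cross G X e ≡ true → is-nothing (τ e) ≡ true → P y ≡ true)
  (balance : ∀ (w : Fin l → ℕ) v → X v ≡ true →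
    sumFin (λ e → maybe′ w 0 (τ e) * mult v (ends G e)) ≡ sumFin (λ b → w b * mult v (B b)))
  (reg-y : P y ≡ true →
    sumFin (λ b → mult y (B b)) + sumFin (λ e → ⟦ cross G X e ⟧ * ⟦ is-nothing (τ e) ⟧) ≡ 5)
  (x : Fin n) (Xx : X x ≡ true) (z : Fin n) (Pz : P z ≡ false) where

  private
    ρ : Fin n → Fin n
    ρ v = if X v then v else y

    ends′ : Fin l ⊎ Fin m → Fin n × Fin n
    ends′ (inj₁ b) = B b
    ends′ (inj₂ e) = ρ (src G e) , ρ (tgt G e)

    H : Graph n (l + m)
    H = record { ends = λ i → ends′ (splitAt l i) }

    -- Edges with both ends outside `X` would become loops at `y`; requiring `touch` discards them.
    kept : Fin m → Bool
    kept e = touch G X e ∧ is-nothing (τ e)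

    Q : Fin l ⊎ Fin m → Bool
    Q (inj₁ b) = true
    Q (inj₂ e) = kept e

    wdeg-H : ∀ (w : Fin l ⊎ Fin m → ℕ) v →
      wdeg H (λ i → ⟦ Q (splitAt l i) ⟧ * w (splitAt l i)) v
        ≡ sumFin (λ b → w (inj₁ b) * mult v (B b))
          + sumFin (λ e → ⟦ kept e ⟧ * w (inj₂ e) * mult v (ends′ (inj₂ e)))
    wdeg-H w v = trans
      (sum-splitAt l λ s → ⟦ Q s ⟧ * w s * mult v (ends′ s))
      (cong (_+ sumFin (λ e → ⟦ kept e ⟧ * w (inj₂ e) * mult v (ends′ (inj₂ e))))
        (sum-cong λ (b : Fin l) → cong (_* mult v (B b)) (*-identityˡ (w (inj₁ b)))))

    merged : (Fin l ⊎ Fin m → ℕ) → Fin m → ℕ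
    merged w e = maybe′ (w ∘ inj₁) (w (inj₂ e)) (τ e)

    ρ-== : ∀ {v} → X v ≡ true → ∀ a → (ρ a == v) ≡ (a == v)
    ρ-== Xv a with X a in Xa
    ... | true = refl
    ... | false = trans (==-false X Xy Xv) (sym (==-false X Xa Xv))

    mult-ρ : ∀ {v} → X v ≡ true → ∀ a b → mult v (ρ a , ρ b) ≡ mult v (a , b)
    mult-ρ {v} Xv a b = mult-cong v (ρ a) (ρ b) v a b (ρ-== Xv a) (ρ-== Xv b)

    -- By `balance`, the new edges weigh at `v` as much as the dropped ones. Constant weight 1 then
    -- gives regularity on `X`, and the weights `is a ∘ col` transfer the colour degrees.
    wdeg-X : ∀ w v → X v ≡ true →
      wdeg H (λ i → ⟦ Q (splitAt l i) ⟧ * w (splitAt l i)) v ≡ wdeg G (merged w) v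
    wdeg-X w v Xv = begin
      wdeg H (λ i → ⟦ Q (splitAt l i) ⟧ * w (splitAt l i)) v
        ≡⟨ wdeg-H w v ⟩
      sumFin (λ b → w (inj₁ b) * mult v (B b))
          + sumFin (λ e → ⟦ kept e ⟧ * w (inj₂ e) * mult v (ends′ (inj₂ e)))
        ≡⟨ cong (_+ sumFin (λ e → ⟦ kept e ⟧ * w (inj₂ e) * mult v (ends′ (inj₂ e)))) (balance (w ∘ inj₁) v Xv) ⟨
      sumFin (λ e → maybe′ (w ∘ inj₁) 0 (τ e) * mult v (ends G e))
          + sumFin (λ e → ⟦ kept e ⟧ * w (inj₂ e) * mult v (ends′ (inj₂ e)))
        ≡⟨ sum-+ {m} _ _ ⟨
      sumFin (λ e → maybe′ (w ∘ inj₁) 0 (τ e) * mult v (ends G e)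
                    + ⟦ kept e ⟧ * w (inj₂ e) * mult v (ends′ (inj₂ e)))
        ≡⟨ sum-cong term ⟩
      wdeg G (merged w) v ∎
      where
      open ≡-Reasoning
      term : ∀ e → maybe′ (w ∘ inj₁) 0 (τ e) * mult v (ends G e)
                    + ⟦ kept e ⟧ * w (inj₂ e) * mult v (ends′ (inj₂ e)) ≡ merged w e * mult v (ends G e)
      term e rewrite mult-ρ Xv (src G e) (tgt G e) with X (src G e) in Xa | X (tgt G e) in Xb | τ e
      ... | false | false | t rewrite mult-outside X Xv Xa Xb = trans (+-identityʳ _)
              (trans (*-zeroʳ (maybe′ (w ∘ inj₁) 0 t)) (sym (*-zeroʳ (maybe′ (w ∘ inj₁) (w (inj₂ e)) t))))
      ... | false | true | just b = +-identityʳ _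
      ... | false | true | nothing = cong (_* mult v (ends G e)) (*-identityˡ (w (inj₂ e)))
      ... | true | _ | just b = +-identityʳ _
      ... | true | _ | nothing = cong (_* mult v (ends G e)) (*-identityˡ (w (inj₂ e)))

    wdeg-y : ∀ w →
      wdeg H (λ i → ⟦ Q (splitAt l i) ⟧ * w (splitAt l i)) y
        ≡ sumFin (λ b → w (inj₁ b) * mult y (B b))
          + sumFin (λ e → ⟦ cross G X e ⟧ * (⟦ is-nothing (τ e) ⟧ * w (inj₂ e)))
    wdeg-y w = trans (wdeg-H w y) (cong (sumFin (λ b → w (inj₁ b) * mult y (B b)) +_) (sum-cong term))
      where
      ≢y : ∀ a → X a ≡ true → (a == y) ≡ false
      ≢y a Xa = trans (==-sym a y) (==-false X Xy Xa)
      term : ∀ e → ⟦ kept e ⟧ * w (inj₂ e) * mult y (ends′ (inj₂ e))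
                   ≡ ⟦ cross G X e ⟧ * (⟦ is-nothing (τ e) ⟧ * w (inj₂ e))
      term e rewrite mult-ind y (ρ (src G e)) (ρ (tgt G e)) with X (src G e) in Xa | X (tgt G e) in Xb
      ... | true | true rewrite ≢y _ Xa | ≢y _ Xb = *-zeroʳ (⟦ is-nothing (τ e) ⟧ * w (inj₂ e))
      ... | true | false rewrite ≢y _ Xa | ==-refl y = *-comm _ 1
      ... | false | true rewrite ≢y _ Xb | ==-refl y = *-comm _ 1
      ... | false | false = refl

    Q⊆P : ∀ s → Q s ≡ true → P (proj₁ (ends′ s)) ≡ true × P (proj₂ (ends′ s)) ≡ true
    Q⊆P (inj₁ b) _ = B⊆P b
    Q⊆P (inj₂ e) Qe with X (src G e) in Xa | X (tgt G e) in Xb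
    ... | true | true = X⊆P _ Xa , X⊆P _ Xb
    ... | true | false = X⊆P _ Xa , kept⇒y∈P e (cong₂ _xor_ Xa Xb) Qe
    ... | false | true = kept⇒y∈P e (cong₂ _xor_ Xa Xb) Qe , X⊆P _ Xb

    regular : ∀ v → P v ≡ true → wdeg H (λ i → ⟦ Q (splitAt l i) ⟧ * 1) v ≡ 5
    regular v Pv with P⊆X+y v Pv
    ... | inj₁ Xv = trans (wdeg-X (λ _ → 1) v Xv) (trans
            (sum-cong λ (e : Fin m) → cong (_* mult v (ends G e)) (merged-1 (τ e)))
            (trans (sym (degree≡wdeg G v)) (reg v)))
      where
      merged-1 : ∀ (t : Maybe (Fin l)) → maybe′ (λ _ → 1) 1 t ≡ 1
      merged-1 (just _) = refl
      merged-1 nothing = refl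
    ... | inj₂ refl = trans (wdeg-y (λ _ → 1)) (trans
            (cong₂ _+_ (sum-cong λ (b : Fin l) → *-identityˡ (mult v (B b)))
                       (sum-cong λ (e : Fin m) → cong (⟦ cross G X e ⟧ *_) (*-identityʳ ⟦ is-nothing (τ e) ⟧)))
            (reg-y Pv))

  private
    colouring : Σ (Fin m → ℕ) λ c → Σ (Fin l → ℕ) λ d →
      GoodOn G X c × (∀ e b → τ e ≡ just b → c e ≡ d b)
      × (P y ≡ true → Good λ a → sumFin (λ b → is a (d b) * mult y (B b))
           + sumFin (λ e → ⟦ cross G X e ⟧ * (⟦ is-nothing (τ e) ⟧ * is a (c e))))
    colouring = c , d , goodX , (λ e b τe → cong (maybe′ d (col (inj₂ e))) τe) , goodY
      where
      Ĥ = subgraph-coloured H smaller P (λ i → Q (splitAt l i)) (λ i → Q⊆P (splitAt l i)) regular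
            x (X⊆P x Xx) z Pz (enum-count P) (enum-count _)
      col : Fin l ⊎ Fin m → ℕ
      col = proj₁ Ĥ ∘ join l m
      c = merged col
      d = col ∘ inj₁
      unsplit : ∀ a v → wdeg H (λ i → ⟦ Q (splitAt l i) ⟧ * is a (proj₁ Ĥ i)) v
                        ≡ wdeg H (λ i → ⟦ Q (splitAt l i) ⟧ * is a (col (splitAt l i))) v
      unsplit a v = sum-cong λ (i : Fin (l + m)) →
        cong (λ t → ⟦ Q (splitAt l i) ⟧ * is a (proj₁ Ĥ t) * mult v (ends H i)) (sym (join-splitAt l m i))
      goodX : GoodOn G X c
      goodX v Xv = good-cong
        (λ a → trans (unsplit a v) (trans (wdeg-X (is a ∘ col) v Xv)
          (sum-cong λ (e : Fin m) → cong (_* mult v (ends G e)) (is-merged a (τ e) (col (inj₂ e))))))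
        (proj₂ Ĥ v (X⊆P v Xv))
        where
        is-merged : ∀ a t k → maybe′ (is a ∘ d) (is a k) t ≡ is a (maybe′ d k t)
        is-merged a (just _) k = refl
        is-merged a nothing k = refl
      goodY : P y ≡ true → Good λ a → sumFin (λ b → is a (d b) * mult y (B b))
           + sumFin (λ e → ⟦ cross G X e ⟧ * (⟦ is-nothing (τ e) ⟧ * is a (c e)))
      goodY Py = good-cong
        (λ a → trans (unsplit a y) (trans (wdeg-y (is a ∘ col))
          (cong (sumFin (λ b → is a (d b) * mult y (B b)) +_)
            (sum-cong λ (e : Fin m) → cong (⟦ cross G X e ⟧ *_) (kept-colour a (τ e) (col (inj₂ e)))))))
        (proj₂ Ĥ y Py)
        where
        kept-colour : ∀ a t k → ⟦ is-nothing t ⟧ * is a k ≡ ⟦ is-nothing t ⟧ * is a (maybe′ d k t)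
        kept-colour a (just _) k = refl
        kept-colour a nothing k = refl

  abstract
    replaced-coloured : Σ (Fin m → ℕ) λ c → Σ (Fin l → ℕ) λ d →
      GoodOn G X c × (∀ e b → τ e ≡ just b → c e ≡ d b)
      × (P y ≡ true → Good λ a → sumFin (λ b → is a (d b) * mult y (B b))
           + sumFin (λ e → ⟦ cross G X e ⟧ * (⟦ is-nothing (τ e) ⟧ * is a (c e))))
    replaced-coloured = colouring

-- Gluing and renaming colours

-- Edges touching `X` follow `c`, all others `c′`. A vertex outside `X` meets edges of the first
-- kind only in the cut, where the two colourings agree.
glue : ∀ {n m} (G : Graph n m) (X : Fin n → Bool) c c′ → 1 ≤ n → GoodOn G X c → GoodOn G (not ∘ X) c′ →
  (∀ e → cross G X e ≡ true → c e ≡ c′ e) → Has41Coloring G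
glue {n} {m} G X c c′ n≥1 goodX goodY agree = has-colouring G n≥1 ĉ good
  where
  ĉ : Fin m → ℕ
  ĉ e = if touch G X e then c e else c′ e
  termX : ∀ a v → X v ≡ true → ∀ e → is a (c e) * mult v (ends G e) ≡ is a (ĉ e) * mult v (ends G e)
  termX a v Xv e with X (src G e) in Xa | X (tgt G e) in Xb
  ... | true | _ = refl
  ... | false | true = refl
  ... | false | false rewrite mult-outside X Xv Xa Xb = trans (*-zeroʳ (is a (c e))) (sym (*-zeroʳ (is a (c′ e))))
  termY : ∀ a v → not (X v) ≡ true → ∀ e → is a (c′ e) * mult v (ends G e) ≡ is a (ĉ e) * mult v (ends G e)
  termY a v Yv e with X (src G e) in Xa | X (tgt G e) in Xb
  ... | true | true rewrite mult-outside (not ∘ X) Yv (cong not Xa) (cong not Xb) =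
          trans (*-zeroʳ (is a (c′ e))) (sym (*-zeroʳ (is a (c e))))
  ... | true | false rewrite agree e (cong₂ _xor_ Xa Xb) = refl
  ... | false | true rewrite agree e (cong₂ _xor_ Xa Xb) = refl
  ... | false | false = refl
  good : ∀ v → GoodAt G ĉ v
  good v with X v in Xv
  ... | true = good-cong (λ a → sum-cong (termX a v Xv)) (goodX v Xv)
  ... | false = good-cong (λ a → sum-cong (termY a v (cong not Xv))) (goodY v (cong not Xv))

-- An injective renaming taking `α` to 0 and, when it differs from `α`, `β` to 1; the shift by two
-- keeps the other colours clear of these values.
recolour : ℕ → ℕ → ℕ → ℕ
recolour α β x with x ℕ.≟ α | x ℕ.≟ β
... | yes _ | _ = 0
... | no _ | yes _ = 1
... | no _ | no _ = suc (suc x)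

recolour-injective : ∀ α β {x y} → recolour α β x ≡ recolour α β y → x ≡ y
recolour-injective α β {x} {y} p with x ℕ.≟ α | x ℕ.≟ β | y ℕ.≟ α | y ℕ.≟ β
... | yes q | _ | yes r | _ = trans q (sym r)
... | no _ | yes q | no _ | yes r = trans q (sym r)
... | no _ | no _ | no _ | no _ = suc-injective (suc-injective p)
recolour-injective α β () | yes _ | _ | no _ | yes _
recolour-injective α β () | yes _ | _ | no _ | no _
recolour-injective α β () | no _ | yes _ | yes _ | _
recolour-injective α β () | no _ | yes _ | no _ | no _
recolour-injective α β () | no _ | no _ | yes _ | _
recolour-injective α β () | no _ | no _ | no _ | yes _

recolour-α : ∀ α β → recolour α β α ≡ 0
recolour-α α β with α ℕ.≟ α
... | yes _ = refl
... | no q = ⊥-elim (q refl)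

recolour-β : ∀ α β → α ≢ β → recolour α β β ≡ 1
recolour-β α β α≢β with β ℕ.≟ α | β ℕ.≟ β
... | yes q | _ = ⊥-elim (α≢β (sym q))
... | no _ | yes _ = refl
... | no _ | no q = ⊥-elim (q refl)

is-recolour : ∀ α β a x → is a x ≡ is (recolour α β a) (recolour α β x)
is-recolour α β a x with x ℕ.≟ a | recolour α β x ℕ.≟ recolour α β a
... | yes _ | yes _ = refl
... | yes refl | no q = ⊥-elim (q refl)
... | no q | yes r = ⊥-elim (q (recolour-injective α β r))
... | no _ | no _ = refl

good-recolour : ∀ {n m} (G : Graph n m) X c α β → GoodOn G X c → GoodOn G X (recolour α β ∘ c)
good-recolour {m = m} G X c α β good v Xv with good v Xv
... | a , b , a≢b , p , q = recolour α β a , recolour α β b , a≢b ∘ recolour-injective α β ,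
      trans (sym (same a)) p , trans (sym (same b)) q
  where
  same : ∀ a → wdeg G (is a ∘ c) v ≡ wdeg G (is (recolour α β a) ∘ recolour α β ∘ c) v
  same a = sum-cong λ (e : Fin m) → cong (_* mult v (ends G e)) (is-recolour α β a (c e))

-- Multiplicities of cut edges, and cuts of three edges

mult-loop : ∀ {n} (y : Fin n) → mult y (y , y) ≡ 2
mult-loop y = trans (mult-ind y y y) (cong (λ b → ⟦ b ⟧ + ⟦ b ⟧) (==-refl y))

cross-cong : ∀ {n m} (G : Graph n m) {X Y : Fin n → Bool} → (∀ v → X v ≡ Y v) →
  ∀ e → cross G X e ≡ cross G Y e
cross-cong G h e = cong₂ _xor_ (h _) (h _)

cross-not : ∀ {n m} (G : Graph n m) (X : Fin n → Bool) e → cross G (not ∘ X) e ≡ cross G X e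
cross-not G X e = not-xor-not (X (src G e)) (X (tgt G e))

inner : ∀ {n m} → Graph n m → (Fin n → Bool) → Fin m → Fin n
inner G X e = if X (src G e) then src G e else tgt G e

inner∈X : ∀ {n m} (G : Graph n m) X e → cross G X e ≡ true → X (inner G X e) ≡ true
inner∈X G X e ce with X (src G e) in Xa
... | true = Xa
... | false = ce

mult-cross : ∀ {n m} (G : Graph n m) X e {v} → X v ≡ true → cross G X e ≡ true →
  mult v (ends G e) ≡ ⟦ inner G X e == v ⟧
mult-cross G X e {v} Xv ce rewrite mult-ind v (src G e) (tgt G e) with X (src G e) in Xa
... | true rewrite ==-false X (not-true ce) Xv = +-identityʳ _
... | false rewrite ==-false X Xa Xv = refl

-- Here `d` is the colour of the loop at the added vertex. The colour of degree 4 must include the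
-- loop, since the three cut edges reach only 3, and therefore contains exactly two of them.
loop-pattern : ∀ d c₁ c₂ c₃ → Good (λ a → is a d * 2 + (is a c₁ + is a c₂ + is a c₃)) →
  (c₁ ≡ c₂ × c₁ ≢ c₃) ⊎ (c₁ ≡ c₃ × c₁ ≢ c₂) ⊎ (c₂ ≡ c₃ × c₂ ≢ c₁)
loop-pattern d c₁ c₂ c₃ (a , _ , _ , p , _) with d ℕ.≟ a | c₁ ℕ.≟ a | c₂ ℕ.≟ a | c₃ ℕ.≟ a
... | yes _ | yes q | yes r | no s = inj₁ (trans q (sym r) , λ t → s (trans (sym t) q))
... | yes _ | yes q | no r | yes s = inj₂ (inj₁ (trans q (sym s) , λ t → r (trans (sym t) q)))
... | yes _ | no q | yes r | yes s = inj₂ (inj₂ (trans r (sym s) , λ t → q (trans (sym t) r)))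
loop-pattern d c₁ c₂ c₃ (a , _ , _ , () , _) | yes _ | yes _ | yes _ | yes _
loop-pattern d c₁ c₂ c₃ (a , _ , _ , () , _) | yes _ | yes _ | no _ | no _
loop-pattern d c₁ c₂ c₃ (a , _ , _ , () , _) | yes _ | no _ | yes _ | no _
loop-pattern d c₁ c₂ c₃ (a , _ , _ , () , _) | yes _ | no _ | no _ | yes _
loop-pattern d c₁ c₂ c₃ (a , _ , _ , () , _) | yes _ | no _ | no _ | no _
loop-pattern d c₁ c₂ c₃ (a , _ , _ , () , _) | no _ | yes _ | yes _ | yes _
loop-pattern d c₁ c₂ c₃ (a , _ , _ , () , _) | no _ | yes _ | yes _ | no _
loop-pattern d c₁ c₂ c₃ (a , _ , _ , () , _) | no _ | yes _ | no _ | yes _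
loop-pattern d c₁ c₂ c₃ (a , _ , _ , () , _) | no _ | yes _ | no _ | no _
loop-pattern d c₁ c₂ c₃ (a , _ , _ , () , _) | no _ | no _ | yes _ | yes _
loop-pattern d c₁ c₂ c₃ (a , _ , _ , () , _) | no _ | no _ | yes _ | no _
loop-pattern d c₁ c₂ c₃ (a , _ , _ , () , _) | no _ | no _ | no _ | yes _
loop-pattern d c₁ c₂ c₃ (a , _ , _ , () , _) | no _ | no _ | no _ | no _

-- The elements are named so that permuting the names lets one construction treat each pair of cut
-- edges.
record Three {m} (q : Fin m → Bool) (e₁ e₂ e₃ : Fin m) : Set where
  field
    q₁ : q e₁ ≡ true
    q₂ : q e₂ ≡ true
    q₃ : q e₃ ≡ true
    e₁≢e₂ : e₁ ≢ e₂
    e₁≢e₃ : e₁ ≢ e₃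
    e₂≢e₃ : e₂ ≢ e₃
    complete : ∀ e → q e ≡ true → e ≡ e₁ ⊎ e ≡ e₂ ⊎ e ≡ e₃
    sum-three : ∀ (g : Fin m → ℕ) → sumFin (λ e → ⟦ q e ⟧ * g e) ≡ g e₁ + g e₂ + g e₃

three-swap : ∀ {m} {q : Fin m → Bool} {e₁ e₂ e₃} → Three q e₁ e₂ e₃ → Three q e₁ e₃ e₂
three-swap {e₁ = e₁} {e₂} {e₃} T = record
  { q₁ = q₁ ; q₂ = q₃ ; q₃ = q₂ ; e₁≢e₂ = e₁≢e₃ ; e₁≢e₃ = e₁≢e₂ ; e₂≢e₃ = e₂≢e₃ ∘ sym
  ; complete = λ e qe → reorder (complete e qe)
  ; sum-three = λ g → trans (sum-three g) (shuffle (g e₁) (g e₂) (g e₃)) }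
  where
  open Three T
  reorder : ∀ {A B C : Set} → A ⊎ B ⊎ C → A ⊎ C ⊎ B
  reorder (inj₁ a) = inj₁ a
  reorder (inj₂ (inj₁ b)) = inj₂ (inj₂ b)
  reorder (inj₂ (inj₂ c)) = inj₂ (inj₁ c)
  shuffle : ∀ a b c → a + b + c ≡ a + c + b
  shuffle = solve-∀

three-rotate : ∀ {m} {q : Fin m → Bool} {e₁ e₂ e₃} → Three q e₁ e₂ e₃ → Three q e₂ e₃ e₁
three-rotate {e₁ = e₁} {e₂} {e₃} T = record
  { q₁ = q₂ ; q₂ = q₃ ; q₃ = q₁ ; e₁≢e₂ = e₂≢e₃ ; e₁≢e₃ = e₁≢e₂ ∘ sym ; e₂≢e₃ = e₁≢e₃ ∘ sym
  ; complete = λ e qe → reorder (complete e qe)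
  ; sum-three = λ g → trans (sum-three g) (shuffle (g e₁) (g e₂) (g e₃)) }
  where
  open Three T
  reorder : ∀ {A B C : Set} → A ⊎ B ⊎ C → B ⊎ C ⊎ A
  reorder (inj₁ a) = inj₂ (inj₂ a)
  reorder (inj₂ (inj₁ b)) = inj₁ b
  reorder (inj₂ (inj₂ c)) = inj₂ (inj₁ c)
  shuffle : ∀ a b c → a + b + c ≡ b + c + a
  shuffle = solve-∀

three-resp : ∀ {m} {q q′ : Fin m → Bool} → (∀ e → q′ e ≡ q e) → ∀ {e₁ e₂ e₃} → Three q e₁ e₂ e₃ → Three q′ e₁ e₂ e₃
three-resp {m} h T = record
  { q₁ = trans (h _) q₁ ; q₂ = trans (h _) q₂ ; q₃ = trans (h _) q₃
  ; e₁≢e₂ = e₁≢e₂ ; e₁≢e₃ = e₁≢e₃ ; e₂≢e₃ = e₂≢e₃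
  ; complete = λ e qe → complete e (trans (sym (h e)) qe)
  ; sum-three = λ g → trans (sum-cong λ (e : Fin m) → cong (λ b → ⟦ b ⟧ * g e) (h e)) (sum-three g) }
  where open Three T

three : ∀ {m} {q : Fin m → Bool} (E : Enum q 3) → let open Enum E in
  Three q (elem zero) (elem (suc zero)) (elem (suc (suc zero)))
three {q = q} E = record
  { q₁ = elem-sound _ ; q₂ = elem-sound _ ; q₃ = elem-sound _
  ; e₁≢e₂ = (λ ()) ∘ elem-injective ; e₁≢e₃ = (λ ()) ∘ elem-injective ; e₂≢e₃ = (λ ()) ∘ elem-injective
  ; complete = compl
  ; sum-three = λ g → trans (sum-elem g)
      (shuffle (g (elem zero)) (g (elem (suc zero))) (g (elem (suc (suc zero))))) }
  where
  open Enum E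
  shuffle : ∀ a b c → a + (b + (c + 0)) ≡ a + b + c
  shuffle = solve-∀
  compl : ∀ e → q e ≡ true → e ≡ elem zero ⊎ e ≡ elem (suc zero) ⊎ e ≡ elem (suc (suc zero))
  compl e qe with elem-complete e qe
  ... | zero , p = inj₁ (sym p)
  ... | suc zero , p = inj₂ (inj₁ (sym p))
  ... | suc (suc zero) , p = inj₂ (inj₂ (sym p))

-- One side of a cut

module Side {n m} (G : Graph n m) (smaller : Smaller n) (reg : Regular 5 G) (X : Fin n → Bool)
  (x : Fin n) (Xx : X x ≡ true) (y : Fin n) (Xy : X y ≡ false) where

  private
    X+y : Fin n → Bool
    X+y v = X v ∨ v == y

    y∈X+y : X+y y ≡ true
    y∈X+y rewrite ==-refl y = ∨-zeroʳ (X y)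

    X⊆X+y : ∀ v → X v ≡ true → X+y v ≡ true
    X⊆X+y v Xv rewrite Xv = refl

    X+y⊆ : ∀ v → X+y v ≡ true → X v ≡ true ⊎ v ≡ y
    X+y⊆ v p with ∨-split {X v} p
    ... | inj₁ Xv = inj₁ Xv
    ... | inj₂ v≡y = inj₂ (==-sound v≡y)

    z∉X+y : ∀ z → X z ≡ false → z ≢ y → X+y z ≡ false
    z∉X+y z Xz z≢y = cong₂ _∨_ Xz (dec-false (z ≟ y) z≢y)

    no-loops-in-X : ∀ {l} (w : Fin l → ℕ) v → X v ≡ true → sumFin (λ b → w b * mult v (y , y)) ≡ 0
    no-loops-in-X {l} w v Xv = trans
      (sum-cong λ (b : Fin l) → trans (cong (w b *_) (mult-outside X Xv Xy Xy)) (*-zeroʳ (w b))) (sum-0 l)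

  -- Nothing replaces the other side, so `y` itself is the missing vertex that makes the graph
  -- smaller.
  closed-coloured : (∀ e → cross G X e ≡ false) → Σ (Fin m → ℕ) (GoodOn G X)
  closed-coloured closed = proj₁ R , proj₁ (proj₂ (proj₂ R))
    where
    R = Replace.replaced-coloured G smaller reg X {0} (λ ()) (λ _ → nothing) X y Xy
      (λ _ → id) (λ _ → inj₁) (λ ()) (λ e ce → ⊥-elim (true≢false ce (closed e)))
      (λ w v Xv → sum-0 m) (λ Xy′ → ⊥-elim (true≢false Xy′ Xy)) x Xx y Xy

  -- The other side shrinks to `y` with `l` loops: two for a bridge, one for a cut of size 3. As `y`
  -- survives, the second vertex `z` is what makes the graph smaller.
  contract : ∀ l → l * 2 + count (cross G X) ≡ 5 → ∀ z → X z ≡ false → z ≢ y →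
    Σ (Fin m → ℕ) λ c → Σ (Fin l → ℕ) λ d → GoodOn G X c
      × Good λ a → sumFin (λ b → is a (d b) * 2) + sumFin (λ e → ⟦ cross G X e ⟧ * is a (c e))
  contract l five z Xz z≢y = proj₁ R , proj₁ (proj₂ R) , proj₁ (proj₂ (proj₂ R)) ,
    good-cong (λ a → cong₂ _+_
        (sum-cong λ (b : Fin l) → cong (is a (proj₁ (proj₂ R) b) *_) (mult-loop y))
        (sum-cong λ (e : Fin m) → cong (⟦ cross G X e ⟧ *_) (*-identityˡ (is a (proj₁ R e)))))
      (proj₂ (proj₂ (proj₂ (proj₂ R))) y∈X+y)
    where
    loops-at-y : sumFin {l} (λ _ → mult y (y , y)) ≡ l * 2
    loops-at-y = trans (sum-cong λ (b : Fin l) → trans (mult-loop y) (sym (*-identityʳ 2)))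
      (trans (sum-*ˡ {l} 2 (λ _ → 1)) (trans (cong (2 *_) (sum-1 l)) (*-comm 2 l)))
    R = Replace.replaced-coloured G smaller reg X {l} (λ _ → y , y) (λ _ → nothing) X+y y Xy
      X⊆X+y X+y⊆ (λ _ → y∈X+y , y∈X+y) (λ _ _ _ → y∈X+y)
      (λ w v Xv → trans (sum-0 m) (sym (no-loops-in-X w v Xv)))
      (λ _ → trans (cong₂ _+_ loops-at-y (sum-cong λ (e : Fin m) → *-identityʳ ⟦ cross G X e ⟧)) five)
      x Xx z (z∉X+y z Xz z≢y)

  private
    module _ (e₁ e₂ : Fin m) (c₁ : cross G X e₁ ≡ true) (c₂ : cross G X e₂ ≡ true) (e₁≢e₂ : e₁ ≢ e₂) where

      u₁ u₂ : Fin n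
      u₁ = inner G X e₁
      u₂ = inner G X e₂

      spliced : ∀ {l} → Fin m → Maybe (Fin (suc l))
      spliced e = if e == e₁ ∨ e == e₂ then just zero else nothing

      spliced₁ : ∀ {l} → spliced {l} e₁ ≡ just zero
      spliced₁ rewrite ==-refl e₁ = refl

      spliced₂ : ∀ {l} → spliced {l} e₂ ≡ just zero
      spliced₂ rewrite ==-refl e₂ | ∨-zeroʳ (e₂ == e₁) = refl

      -- Index `zero` is the edge joining the inner ends of the spliced pair; the remaining indices
      -- are loops at `y`, none for a cut of size 2 and two for a cut of size 3.
      extra : ∀ {l} → Fin (suc l) → Fin n × Fin n
      extra zero = u₁ , u₂
      extra (suc _) = y , y

      -- Inside `X` a cut edge counts only at its inner end, so the pair counts as the edge joining
      -- those ends, even if they coincide and that edge is a loop.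
      splice-balance : ∀ {l} (w : Fin (suc l) → ℕ) v → X v ≡ true →
        sumFin (λ e → maybe′ w 0 (spliced e) * mult v (ends G e)) ≡ sumFin (λ b → w b * mult v (extra b))
      splice-balance {l} w v Xv = begin
        sumFin (λ e → maybe′ w 0 (spliced e) * mult v (ends G e))
          ≡⟨ sum-cong term ⟩
        sumFin (λ e → ⟦ e == e₁ ⟧ * t e + ⟦ e == e₂ ⟧ * t e)
          ≡⟨ sum-+ {m} _ _ ⟩
        sumFin (λ e → ⟦ e == e₁ ⟧ * t e) + sumFin (λ e → ⟦ e == e₂ ⟧ * t e)
          ≡⟨ cong₂ _+_ (sum-δ e₁ t) (sum-δ e₂ t) ⟩
        t e₁ + t e₂
          ≡⟨ cong₂ (λ p q → w zero * p + w zero * q) (mult-cross G X e₁ Xv c₁) (mult-cross G X e₂ Xv c₂) ⟩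
        w zero * ⟦ u₁ == v ⟧ + w zero * ⟦ u₂ == v ⟧
          ≡⟨ *-distribˡ-+ (w zero) ⟦ u₁ == v ⟧ ⟦ u₂ == v ⟧ ⟨
        w zero * (⟦ u₁ == v ⟧ + ⟦ u₂ == v ⟧)
          ≡⟨ cong (w zero *_) (mult-ind v u₁ u₂) ⟨
        w zero * mult v (u₁ , u₂)
          ≡⟨ +-identityʳ _ ⟨
        w zero * mult v (u₁ , u₂) + 0
          ≡⟨ cong (w zero * mult v (u₁ , u₂) +_) (no-loops-in-X (w ∘ suc) v Xv) ⟨
        sumFin (λ b → w b * mult v (extra b)) ∎
        where
        open ≡-Reasoning
        t : Fin m → ℕ
        t e = w zero * mult v (ends G e)
        term : ∀ e → maybe′ w 0 (spliced e) * mult v (ends G e) ≡ ⟦ e == e₁ ⟧ * t e + ⟦ e == e₂ ⟧ * t e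
        term e with e ≟ e₁ | e ≟ e₂
        ... | yes p | yes q = ⊥-elim (e₁≢e₂ (trans (sym p) q))
        ... | yes _ | no _ = sym (trans (+-identityʳ _) (*-identityˡ (t e)))
        ... | no _ | yes _ = sym (*-identityˡ (t e))
        ... | no _ | no _ = refl

  -- Both cut edges inherit the colour of the one edge replacing them. No cut edge is kept, so `y`
  -- can be left out.
  splice-two : ∀ e₁ e₂ → cross G X e₁ ≡ true → cross G X e₂ ≡ true → e₁ ≢ e₂ →
    (∀ e → cross G X e ≡ true → e ≡ e₁ ⊎ e ≡ e₂) →
    Σ (Fin m → ℕ) λ c → GoodOn G X c × c e₁ ≡ c e₂
  splice-two e₁ e₂ c₁ c₂ e₁≢e₂ only = proj₁ R , proj₁ (proj₂ (proj₂ R)) ,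
    trans (same e₁ zero (spliced₁ e₁ e₂ c₁ c₂ e₁≢e₂)) (sym (same e₂ zero (spliced₂ e₁ e₂ c₁ c₂ e₁≢e₂)))
    where
    τ : Fin m → Maybe (Fin 1)
    τ = spliced e₁ e₂ c₁ c₂ e₁≢e₂
    none-kept : ∀ e → cross G X e ≡ true → is-nothing (τ e) ≡ true → X y ≡ true
    none-kept e ce p with only e ce
    ... | inj₁ refl = ⊥-elim (true≢false p (cong is-nothing (spliced₁ e₁ e₂ c₁ c₂ e₁≢e₂)))
    ... | inj₂ refl = ⊥-elim (true≢false p (cong is-nothing (spliced₂ e₁ e₂ c₁ c₂ e₁≢e₂)))
    R = Replace.replaced-coloured G smaller reg X {1} (extra e₁ e₂ c₁ c₂ e₁≢e₂) τ X y Xy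
      (λ _ → id) (λ _ → inj₁) (λ { zero → inner∈X G X e₁ c₁ , inner∈X G X e₂ c₂ }) none-kept
      (splice-balance e₁ e₂ c₁ c₂ e₁≢e₂) (λ Xy′ → ⊥-elim (true≢false Xy′ Xy)) x Xx y Xy
    same = proj₁ (proj₂ (proj₂ (proj₂ R)))

  -- The pair `e₁`, `e₂` is spliced, while `e₃` now ends at `y`, where two loops complete the degree
  -- to 5.
  splice-three : ∀ {e₁ e₂ e₃} → Three (cross G X) e₁ e₂ e₃ → ∀ z → X z ≡ false → z ≢ y →
    Σ (Fin m → ℕ) λ c → GoodOn G X c × c e₁ ≡ c e₂
  splice-three {e₁} {e₂} {e₃} T z Xz z≢y = proj₁ R , proj₁ (proj₂ (proj₂ R)) ,
    trans (same e₁ zero (spliced₁ e₁ e₂ q₁ q₂ e₁≢e₂)) (sym (same e₂ zero (spliced₂ e₁ e₂ q₁ q₂ e₁≢e₂)))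
    where
    open Three T
    τ : Fin m → Maybe (Fin 3)
    τ = spliced e₁ e₂ q₁ q₂ e₁≢e₂
    kept₃ : is-nothing (τ e₃) ≡ true
    kept₃ rewrite dec-false (e₃ ≟ e₁) (e₁≢e₃ ∘ sym) | dec-false (e₃ ≟ e₂) (e₂≢e₃ ∘ sym) = refl
    five : mult y (inner G X e₁ , inner G X e₂) + (mult y (y , y) + (mult y (y , y) + 0))
      + sumFin (λ e → ⟦ cross G X e ⟧ * ⟦ is-nothing (τ e) ⟧) ≡ 5
    five rewrite sum-three (λ e → ⟦ is-nothing (τ e) ⟧) | spliced₁ e₁ e₂ q₁ q₂ e₁≢e₂ {2}
      | spliced₂ e₁ e₂ q₁ q₂ e₁≢e₂ {2} | kept₃ | mult-loop y
      | mult-outside (not ∘ X) {y} (cong not Xy) (cong not (inner∈X G X e₁ q₁)) (cong not (inner∈X G X e₂ q₂)) = refl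
    R = Replace.replaced-coloured G smaller reg X {3} (extra e₁ e₂ q₁ q₂ e₁≢e₂) τ X+y y Xy
      X⊆X+y X+y⊆ (λ { zero → X⊆X+y _ (inner∈X G X e₁ q₁) , X⊆X+y _ (inner∈X G X e₂ q₂) ; (suc _) → y∈X+y , y∈X+y })
      (λ _ _ _ → y∈X+y)
      (splice-balance e₁ e₂ q₁ q₂ e₁≢e₂) (λ _ → five) x Xx z (z∉X+y z Xz z≢y)
    same = proj₁ (proj₂ (proj₂ (proj₂ R)))

-- Patterns of colours on a cut

-- Patterns are kept in normal form with colours 0 and 1, so that colourings of the two sides with
-- the same pattern agree literally on the cut and can be glued.
Zero₁ : ∀ {n m} → Graph n m → (Fin n → Bool) → Fin m → Set
Zero₁ {m = m} G X e = Σ (Fin m → ℕ) λ c → GoodOn G X c × c e ≡ 0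

Zero₂ : ∀ {n m} → Graph n m → (Fin n → Bool) → Fin m → Fin m → Set
Zero₂ {m = m} G X e₁ e₂ = Σ (Fin m → ℕ) λ c → GoodOn G X c × c e₁ ≡ 0 × c e₂ ≡ 0

Zero₃ : ∀ {n m} → Graph n m → (Fin n → Bool) → Fin m → Fin m → Fin m → Set
Zero₃ {m = m} G X e₁ e₂ e₃ = Σ (Fin m → ℕ) λ c → GoodOn G X c × c e₁ ≡ 0 × c e₂ ≡ 0 × c e₃ ≡ 0

ZeroZeroOne : ∀ {n m} → Graph n m → (Fin n → Bool) → Fin m → Fin m → Fin m → Set
ZeroZeroOne {m = m} G X e₁ e₂ e₃ = Σ (Fin m → ℕ) λ c → GoodOn G X c × c e₁ ≡ 0 × c e₂ ≡ 0 × c e₃ ≡ 1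

module _ {n m} (G : Graph n m) (X : Fin n → Bool) (c : Fin m → ℕ) (good : GoodOn G X c) where

  zero₁ : ∀ e → Zero₁ G X e
  -- The second argument of `recolour` is arbitrary here: only the colour sent to 0 matters.
  zero₁ e = recolour (c e) 0 ∘ c , good-recolour G X c (c e) 0 good , recolour-α (c e) 0

  zero₂ : ∀ e₁ e₂ → c e₁ ≡ c e₂ → Zero₂ G X e₁ e₂
  zero₂ e₁ e₂ p = recolour (c e₁) 0 ∘ c , good-recolour G X c (c e₁) 0 good , recolour-α (c e₁) 0 ,
    trans (cong (recolour (c e₁) 0) (sym p)) (recolour-α (c e₁) 0)

  zero₃ : ∀ e₁ e₂ e₃ → c e₁ ≡ c e₂ → c e₁ ≡ c e₃ → Zero₃ G X e₁ e₂ e₃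
  zero₃ e₁ e₂ e₃ p q = recolour (c e₁) 0 ∘ c , good-recolour G X c (c e₁) 0 good , recolour-α (c e₁) 0 ,
    trans (cong (recolour (c e₁) 0) (sym p)) (recolour-α (c e₁) 0) ,
    trans (cong (recolour (c e₁) 0) (sym q)) (recolour-α (c e₁) 0)

  zeroZeroOne : ∀ e₁ e₂ e₃ → c e₁ ≡ c e₂ → c e₁ ≢ c e₃ → ZeroZeroOne G X e₁ e₂ e₃
  zeroZeroOne e₁ e₂ e₃ p q = recolour (c e₁) (c e₃) ∘ c , good-recolour G X c (c e₁) (c e₃) good , recolour-α (c e₁) (c e₃) ,
    trans (cong (recolour (c e₁) (c e₃)) (sym p)) (recolour-α (c e₁) (c e₃)) , recolour-β (c e₁) (c e₃) q

  zero₃-or-one : ∀ e₁ e₂ e₃ → c e₁ ≡ c e₂ → Zero₃ G X e₁ e₂ e₃ ⊎ ZeroZeroOne G X e₁ e₂ e₃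
  zero₃-or-one e₁ e₂ e₃ p with c e₁ ℕ.≟ c e₃
  ... | yes q = inj₁ (zero₃ e₁ e₂ e₃ p q)
  ... | no q = inj₂ (zeroZeroOne e₁ e₂ e₃ p q)

module ThreeCut {n m} (G : Graph n m) (smaller : Smaller n) (reg : Regular 5 G) (X : Fin n → Bool)
  (x : Fin n) (Xx : X x ≡ true) (y : Fin n) (Xy : X y ≡ false)
  (z : Fin n) (Xz : X z ≡ false) (z≢y : z ≢ y)
  {e₁ e₂ e₃} (T : Three (cross G X) e₁ e₂ e₃) where

  open Side G smaller reg X x Xx y Xy

  count-three : count (cross G X) ≡ 3
  count-three = trans (sum-cong λ (e : Fin m) → sym (*-identityʳ ⟦ cross G X e ⟧)) (Three.sum-three T (λ _ → 1))

  some-two : ZeroZeroOne G X e₁ e₂ e₃ ⊎ ZeroZeroOne G X e₁ e₃ e₂ ⊎ ZeroZeroOne G X e₂ e₃ e₁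
  some-two = conclude (loop-pattern (d zero) (c e₁) (c e₂) (c e₃)
      (good-cong (λ a → cong₂ _+_ (+-identityʳ (is a (d zero) * 2)) (Three.sum-three T (is a ∘ c)))
        (proj₂ (proj₂ (proj₂ R)))))
    where
    R = contract 1 (cong (2 +_) count-three) z Xz z≢y
    c = proj₁ R
    d = proj₁ (proj₂ R)
    good = proj₁ (proj₂ (proj₂ R))
    conclude : (c e₁ ≡ c e₂ × c e₁ ≢ c e₃) ⊎ (c e₁ ≡ c e₃ × c e₁ ≢ c e₂) ⊎ (c e₂ ≡ c e₃ × c e₂ ≢ c e₁) →
      ZeroZeroOne G X e₁ e₂ e₃ ⊎ ZeroZeroOne G X e₁ e₃ e₂ ⊎ ZeroZeroOne G X e₂ e₃ e₁
    conclude (inj₁ (p , q)) = inj₁ (zeroZeroOne G X c good e₁ e₂ e₃ p q)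
    conclude (inj₂ (inj₁ (p , q))) = inj₂ (inj₁ (zeroZeroOne G X c good e₁ e₃ e₂ p q))
    conclude (inj₂ (inj₂ (p , q))) = inj₂ (inj₂ (zeroZeroOne G X c good e₂ e₃ e₁ p q))

  -- Splicing each pair in turn makes that pair agree. If the remaining edge agrees as well in one
  -- of the three colourings, the constant pattern arises; otherwise all three two-equal patterns
  -- do.
  all-equal-or-every-two : Zero₃ G X e₁ e₂ e₃
    ⊎ (ZeroZeroOne G X e₁ e₂ e₃ × ZeroZeroOne G X e₁ e₃ e₂ × ZeroZeroOne G X e₂ e₃ e₁)
  all-equal-or-every-two = conclude
      (pattern-of e₁ e₂ e₃ (splice-three T z Xz z≢y))
      (pattern-of e₁ e₃ e₂ (splice-three (three-swap T) z Xz z≢y))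
      (pattern-of e₂ e₃ e₁ (splice-three (three-rotate T) z Xz z≢y))
    where
    pattern-of : ∀ f₁ f₂ f₃ → (Σ (Fin m → ℕ) λ c → GoodOn G X c × c f₁ ≡ c f₂) →
      Zero₃ G X f₁ f₂ f₃ ⊎ ZeroZeroOne G X f₁ f₂ f₃
    pattern-of f₁ f₂ f₃ (c , good , p) = zero₃-or-one G X c good f₁ f₂ f₃ p
    conclude : Zero₃ G X e₁ e₂ e₃ ⊎ ZeroZeroOne G X e₁ e₂ e₃ → Zero₃ G X e₁ e₃ e₂ ⊎ ZeroZeroOne G X e₁ e₃ e₂ →
      Zero₃ G X e₂ e₃ e₁ ⊎ ZeroZeroOne G X e₂ e₃ e₁ →
      Zero₃ G X e₁ e₂ e₃ ⊎ (ZeroZeroOne G X e₁ e₂ e₃ × ZeroZeroOne G X e₁ e₃ e₂ × ZeroZeroOne G X e₂ e₃ e₁)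
    conclude (inj₁ s) _ _ = inj₁ s
    conclude (inj₂ _) (inj₁ (k , h , r₁ , r₃ , r₂)) _ = inj₁ (k , h , r₁ , r₂ , r₃)
    conclude (inj₂ _) (inj₂ _) (inj₁ (k , h , r₂ , r₃ , r₁)) = inj₁ (k , h , r₁ , r₂ , r₃)
    conclude (inj₂ t₁) (inj₂ t₂) (inj₂ t₃) = inj₂ (t₁ , t₂ , t₃)

-- Cuts around a single vertex

module _ {n m} (G : Graph n m) (x : Fin n) where

  loop-at : Fin m → Bool
  loop-at e = src G e == x ∧ tgt G e == x

  mult-single : ∀ e → mult x (ends G e) ≡ ⟦ cross G (_== x) e ⟧ + 2 * ⟦ loop-at e ⟧
  mult-single e rewrite mult-ind x (src G e) (tgt G e) with src G e == x | tgt G e == x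
  ... | true | true = refl
  ... | true | false = refl
  ... | false | true = refl
  ... | false | false = refl

  degree-single : degree G x ≡ count (cross G (_== x)) + 2 * loops G x
  degree-single = trans (sum-cong mult-single) (trans
    (sum-+ {m} (λ e → ⟦ cross G (_== x) e ⟧) (λ e → 2 * ⟦ loop-at e ⟧))
    (cong (count (cross G (_== x)) +_)
      (trans (sum-*ˡ {m} 2 (λ e → ⟦ loop-at e ⟧)) (cong (2 *_) (sym (loops≡sum G x))))))

  -- Degree 5 with a single edge leaving `x` forces two loops, whose common colour 1 then has degree
  -- 4, while the leaving edge gives colour 0 degree 1.
  pendant-good : degree G x ≡ 5 → count (cross G (_== x)) ≡ 1 → ∀ c →
    (∀ e → cross G (_== x) e ≡ true → c e ≡ 0) → (∀ e → loop-at e ≡ true → c e ≡ 1) → GoodAt G c x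
  pendant-good deg one c c-cross c-loop = 1 , 0 , (λ ()) ,
    trans (sum-cong term₁) (trans (sum-*ˡ {m} 2 (λ e → ⟦ loop-at e ⟧)) (trans (cong (2 *_) (sym (loops≡sum G x))) four)) ,
    trans (sum-cong term₀) one
    where
    four : 2 * loops G x ≡ 4
    four = suc-injective (trans (sym (trans degree-single (cong (_+ 2 * loops G x) one))) deg)
    term₁ : ∀ e → is 1 (c e) * mult x (ends G e) ≡ 2 * ⟦ loop-at e ⟧
    term₁ e rewrite mult-single e with cross G (_== x) e in ce | loop-at e in le
    ... | true | true = ⊥-elim (0≢1+n (trans (sym (c-cross e ce)) (c-loop e le)))
    ... | true | false rewrite c-cross e ce = refl
    ... | false | true rewrite c-loop e le = refl
    ... | false | false = *-zeroʳ (is 1 (c e))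
    term₀ : ∀ e → is 0 (c e) * mult x (ends G e) ≡ ⟦ cross G (_== x) e ⟧
    term₀ e rewrite mult-single e with cross G (_== x) e in ce | loop-at e in le
    ... | true | true = ⊥-elim (0≢1+n (trans (sym (c-cross e ce)) (c-loop e le)))
    ... | true | false rewrite c-cross e ce = refl
    ... | false | true rewrite c-loop e le = refl
    ... | false | false = *-zeroʳ (is 0 (c e))

  loop⇒¬cross : ∀ e → loop-at e ≡ true → cross G (_== x) e ≡ false
  loop⇒¬cross e le with src G e == x | tgt G e == x
  ... | true | true = refl

-- Shrinking a side to one vertex makes the graph smaller only if that side has a second vertex;
-- this is the corresponding case distinction.
another-or-single : ∀ {n} (X : Fin n → Bool) x → X x ≡ true →
  (Σ (Fin n) λ z → X z ≡ true × z ≢ x) ⊎ (∀ v → X v ≡ (v == x))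
another-or-single X x Xx with any? (λ z → (X z Bool.≟ true) ×-dec (¬? (z ≟ x)))
... | yes p = inj₁ p
... | no p = inj₂ same
  where
  same : ∀ v → X v ≡ (v == x)
  same v with v ≟ x | X v in Xv
  ... | yes refl | true = refl
  ... | yes refl | false = ⊥-elim (true≢false Xx Xv)
  ... | no q | true = ⊥-elim (p (v , Xv , q))
  ... | no _ | false = refl

∣∣≡count : ∀ {m} (S : Subset m) → ∣ S ∣ ≡ count (lookup S)
∣∣≡count [] = refl
∣∣≡count (true ∷ S) = cong suc (∣∣≡count S)
∣∣≡count (false ∷ S) = ∣∣≡count S

unique-of-count-1 : ∀ {m} {q : Fin m → Bool} → count q ≡ 1 → ∀ {e f} → q e ≡ true → q f ≡ true → e ≡ f
unique-of-count-1 {q = q} one {e} {f} qe qf with subst (Enum q) one (enum-count q)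
... | E with Enum.elem-complete E e qe | Enum.elem-complete E f qf
...   | zero , p | zero , r = trans (sym p) r

count-1-of-unique : ∀ {m} (q : Fin m → Bool) e → q e ≡ true → (∀ f → q f ≡ true → f ≡ e) → count q ≡ 1
count-1-of-unique {m} q e qe only = trans (sum-cong term) (sum-δ-1 e)
  where
  term : ∀ f → ⟦ q f ⟧ ≡ ⟦ f == e ⟧
  term f with f ≟ e | q f in qf
  ... | yes refl | true = refl
  ... | yes refl | false = ⊥-elim (true≢false qe qf)
  ... | no p | true = ⊥-elim (p (only f qf))
  ... | no _ | false = refl

-- Reachability

reach-trans : ∀ {n m} {G : Graph n m} {S u v w} → Reach G S u v → Reach G S v w → Reach G S u w
reach-trans here q = q
reach-trans (step e e∉S j p) q = step e e∉S j (reach-trans p q)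

reach-sym : ∀ {n m} {G : Graph n m} {S u v} → Reach G S u v → Reach G S v u
reach-sym here = here
reach-sym (step e e∉S j p) = reach-trans (reach-sym p) (step e e∉S (swap j) here)

xor-false : ∀ {a b} → (a xor b) ≡ false → a ≡ b
xor-false {true} {true} _ = refl
xor-false {false} {false} _ = refl

joins-cross : ∀ {n m} (G : Graph n m) X e {u v} → Joins G e u v → cross G X e ≡ false → X u ≡ X v
joins-cross G X e (inj₁ p) ce rewrite p = xor-false ce
joins-cross G X e (inj₂ p) ce rewrite p = sym (xor-false ce)

reach-invariant : ∀ {n m} (G : Graph n m) S X → (∀ e → cross G X e ≡ true → e ∈ S) →
  ∀ {u v} → Reach G S u v → X u ≡ X v
reach-invariant G S X δ⊆S here = refl
reach-invariant G S X δ⊆S (step e e∉S j p) with cross G X e in ce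
... | true = ⊥-elim (e∉S (δ⊆S e ce))
... | false = trans (joins-cross G X e j ce) (reach-invariant G S X δ⊆S p)

-- A positive form of `EdgeCut`, which is only a negation: a vertex set with both sides inhabited
-- and its boundary inside `S`.
record ClosedSet {n m} (G : Graph n m) (S : Subset m) : Set where
  field
    X : Fin n → Bool
    x : Fin n
    Xx : X x ≡ true
    y : Fin n
    Xy : X y ≡ false
    δ⊆S : ∀ e → cross G X e ≡ true → e ∈ S

closed-set⇒cut : ∀ {n m} {G : Graph n m} {S} → ClosedSet G S → EdgeCut G S
closed-set⇒cut {G = G} {S} C conn =
  true≢false (trans (sym (reach-invariant G S X δ⊆S (conn x y))) Xx) Xy
  where open ClosedSet C

crossing-joins : ∀ {n m} (G : Graph n m) X e → cross G X e ≡ true →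
  Σ (Fin n) λ u → Σ (Fin n) λ v → X u ≡ true × X v ≡ false × Joins G e u v
crossing-joins G X e ce with xor-split {X (src G e)} ce
... | inj₁ (Xa , Xb) = _ , _ , Xa , Xb , inj₁ refl
... | inj₂ (Xa , Xb) = _ , _ , Xb , Xa , inj₂ refl

module _ {n m} (G : Graph n m) (S : Subset m) (u : Fin n) where

  private
    -- Search from `u`: while some edge outside `S` leaves `X`, its outer end is added. The number
    -- `k` bounds how many vertices are still missing, so it decreases with each addition.
    grow : ∀ k (X : Fin n → Bool) → X u ≡ true → (∀ v → X v ≡ true → Reach G S u v) → n ≤ count X + k →
      (∀ v → Reach G S u v) ⊎ ClosedSet G S
    grow k X Xu reach bound with any? (λ e → (cross G X e Bool.≟ true) ×-dec (lookup S e Bool.≟ false))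
    ... | no closed with any? (λ v → X v Bool.≟ false)
    ...   | yes (y , Xy) = inj₂ (record { X = X ; x = u ; Xx = Xu ; y = y ; Xy = Xy ; δ⊆S = δ⊆S })
      where
      δ⊆S : ∀ e → cross G X e ≡ true → e ∈ S
      δ⊆S e ce with lookup S e in Se
      ... | true = lookup⇒[]= e S Se
      ... | false = ⊥-elim (closed (e , ce , Se))
    ...   | no full = inj₁ everywhere
      where
      everywhere : ∀ v → Reach G S u v
      everywhere v with X v in Xv
      ... | true = reach v Xv
      ... | false = ⊥-elim (full (v , Xv))
    grow k X Xu reach bound | yes (e , ce , Se) with crossing-joins G X e ce
    grow zero X Xu reach bound | yes (e , ce , Se) | a , b , Xa , Xb , j =
      ⊥-elim (<-irrefl refl (<-≤-trans (count<size X b Xb) (subst (n ≤_) (+-identityʳ _) bound)))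
    grow (suc k) X Xu reach bound | yes (e , ce , Se) | a , b , Xa , Xb , j =
      grow k X′ (cong (_∨ u == b) Xu) reach′ (≤-trans bound bound′)
      where
      X′ : Fin n → Bool
      X′ v = X v ∨ v == b
      reach′ : ∀ v → X′ v ≡ true → Reach G S u v
      reach′ v X′v with ∨-split {X v} X′v
      ... | inj₁ Xv = reach v Xv
      ... | inj₂ v≡b rewrite ==-sound {u = v} {b} v≡b = reach-trans (reach a Xa)
              (step e (λ e∈S → true≢false ([]=⇒lookup e∈S) Se) j here)
      term : ∀ v → ⟦ X v ⟧ + ⟦ v == b ⟧ ≤ ⟦ X′ v ⟧
      term v with v ≟ b
      ... | yes refl rewrite Xb = ≤-refl
      ... | no _ with X v
      ...   | true = ≤-refl
      ...   | false = ≤-refl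
      bound′ : count X + suc k ≤ count X′ + k
      bound′ = begin
        count X + suc k                             ≡⟨ +-assoc (count X) 1 k ⟨
        count X + 1 + k                             ≡⟨ cong (λ t → count X + t + k) (sum-δ-1 b) ⟨
        count X + sumFin (λ v → ⟦ v == b ⟧) + k     ≡⟨ cong (_+ k) (sum-+ (λ v → ⟦ X v ⟧) (λ v → ⟦ v == b ⟧)) ⟨
        sumFin (λ v → ⟦ X v ⟧ + ⟦ v == b ⟧) + k     ≤⟨ +-monoˡ-≤ k (sum-mono term) ⟩
        count X′ + k                                ∎
        where open ≤-Reasoning

  reaches-all-or-closed-set : (∀ v → Reach G S u v) ⊎ ClosedSet G S
  reaches-all-or-closed-set =
    grow n (_== u) (==-refl u) (λ v p → subst (Reach G S u) (sym (==-sound p)) here) (m≤n+m n _)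

connected-or-closed-set : ∀ {n m} (G : Graph n m) S → ConnectedMinus G S ⊎ ClosedSet G S
connected-or-closed-set {zero} G S = inj₁ λ ()
connected-or-closed-set {suc n} G S with reaches-all-or-closed-set G S zero
... | inj₁ all = inj₁ λ u v → reach-trans (reach-sym (all u)) (all v)
... | inj₂ C = inj₂ C

cut⇒closed-set : ∀ {n m} (G : Graph n m) S → EdgeCut G S → ClosedSet G S
cut⇒closed-set G S cut with connected-or-closed-set G S
... | inj₁ conn = ⊥-elim (cut conn)
... | inj₂ C = C

-- If an edge of `S` did not cross `X`, then `X` would still witness that `S` without that edge is a
-- cut, against minimality.
minimal-cut-exact : ∀ {n m} (G : Graph n m) S → MinimalEdgeCut G S → (C : ClosedSet G S) →
  ∀ e → cross G (ClosedSet.X C) e ≡ lookup S e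
minimal-cut-exact G S (_ , minimal) C e with cross G X e in ce | lookup S e in Se
  where open ClosedSet C
... | true | true = refl
... | false | false = refl
... | true | false = ⊥-elim (true≢false ([]=⇒lookup (δ⊆S e ce)) Se)
  where open ClosedSet C
... | false | true = ⊥-elim (closed-set⇒cut C′ (minimal e (lookup⇒[]= e S Se)))
  where
  open ClosedSet C
  C′ : ClosedSet G (S [ e ]≔ outside)
  C′ = record { X = X ; x = x ; Xx = Xx ; y = y ; Xy = Xy ; δ⊆S = δ⊆S′ }
    where
    δ⊆S′ : ∀ f → cross G X f ≡ true → f ∈ S [ e ]≔ outside
    δ⊆S′ f cf with f ≟ e
    ... | yes refl = ⊥-elim (true≢false cf ce)
    ... | no f≢e = lookup⇒[]= f _ (trans (lookup∘update′ f≢e S outside) ([]=⇒lookup (δ⊆S f cf)))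

-- Small cuts of a minimal counterexample

cross-∨ : ∀ {n m} (G : Graph n m) (X Y : Fin n → Bool) e → cross G (λ v → X v ∨ Y v) e ≡ true →
  cross G X e ≡ true ⊎ cross G Y e ≡ true
cross-∨ G X Y e = go (X (src G e)) (Y (src G e)) (X (tgt G e)) (Y (tgt G e))
  where
  go : ∀ a₁ a₂ b₁ b₂ → ((a₁ ∨ a₂) xor (b₁ ∨ b₂)) ≡ true → (a₁ xor b₁) ≡ true ⊎ (a₂ xor b₂) ≡ true
  go true _ false false p = inj₁ refl
  go false true false false p = inj₂ refl
  go false false true _ p = inj₁ refl
  go false false false true p = inj₂ refl
  go false true true _ p = inj₁ refl
  go true true false true ()
  go true false false true ()

-- The end other than `x` cannot be `y`, or the edge would cross `{y}` as well.
cross-single-∨ : ∀ {n m} (G : Graph n m) x y e → x ≢ y →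
  cross G (_== x) e ≡ true → cross G (_== y) e ≡ false → cross G (λ v → v == x ∨ v == y) e ≡ true
cross-single-∨ G x y e x≢y p q with src G e ≟ x | tgt G e ≟ x | src G e ≟ y | tgt G e ≟ y
... | yes s | no _ | yes t | _ = ⊥-elim (x≢y (trans (sym s) t))
... | yes s | no _ | no _ | no _ = refl
... | no _ | yes s | _ | yes t = ⊥-elim (x≢y (trans (sym s) t))
... | no _ | yes s | no _ | no _ = refl

module Reductions {n m} (G : Graph n m) (mc : MinimalCounterexample G) where

  private
    n≥1 = proj₁ mc
    reg = proj₁ (proj₂ mc)
    uncolourable = proj₁ (proj₂ (proj₂ mc))
    smaller = proj₂ (proj₂ (proj₂ mc))

  -- With no crossing edge, each side is coloured by itself and the gluing condition is vacuous.
  crossing-edge : ∀ X x y → X x ≡ true → X y ≡ false → Σ (Fin m) λ e → cross G X e ≡ true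
  crossing-edge X x y Xx Xy with any? (λ e → cross G X e Bool.≟ true)
  ... | yes p = p
  ... | no none = ⊥-elim (uncolourable (glue G X (proj₁ cX) (proj₁ cY) n≥1 (proj₂ cX) (proj₂ cY)
                    λ e ce → ⊥-elim (none (e , ce))))
    where
    closed : ∀ e → cross G X e ≡ false
    closed e with cross G X e in ce
    ... | true = ⊥-elim (none (e , ce))
    ... | false = refl
    cX = Side.closed-coloured G smaller reg X x Xx y Xy closed
    cY = Side.closed-coloured G smaller reg (not ∘ X) y (cong not Xy) x (cong not Xx)
           λ e → trans (cross-not G X e) (closed e)

  connected : Connected G
  connected with connected-or-closed-set G ∅
  ... | inj₁ conn = conn
  ... | inj₂ C = ⊥-elim (∉⊥ (δ⊆S _ (proj₂ (crossing-edge X x y Xx Xy))))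
    where open ClosedSet C

  -- Splicing gives `X` a colouring with equal colours on the cut. The colouring of the other side
  -- is left as input: for a minimal cut it also comes from splicing, for two bridges it is written
  -- down directly.
  no-2-cut : ∀ X x y → X x ≡ true → X y ≡ false → ∀ e₁ e₂ → e₁ ≢ e₂ →
    cross G X e₁ ≡ true → cross G X e₂ ≡ true → (∀ e → cross G X e ≡ true → e ≡ e₁ ⊎ e ≡ e₂) →
    ¬ Zero₂ G (not ∘ X) e₁ e₂
  no-2-cut X x y Xx Xy e₁ e₂ e₁≢e₂ c₁ c₂ only (cY , goodY , cY₁ , cY₂)
    with Side.splice-two G smaller reg X x Xx y Xy e₁ e₂ c₁ c₂ e₁≢e₂ only
  ... | c , good , eq with zero₂ G X c good e₁ e₂ eq
  ...   | cX , goodX , cX₁ , cX₂ = uncolourable (glue G X cX cY n≥1 goodX goodY agree)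
    where
    agree : ∀ e → cross G X e ≡ true → cX e ≡ cY e
    agree e ce with only e ce
    ... | inj₁ refl = trans cX₁ (sym cY₁)
    ... | inj₂ refl = trans cX₂ (sym cY₂)

  no-minimal-2-cut : ∀ S → MinimalEdgeCut G S → ∣ S ∣ ≢ 2
  no-minimal-2-cut S minimal two =
    no-2-cut X x y Xx Xy e₁ e₂ e₁≢e₂ c₁ c₂ only
      (zero₂ G (not ∘ X) (proj₁ other) (proj₁ (proj₂ other)) e₁ e₂ (proj₂ (proj₂ other)))
    where
    C = cut⇒closed-set G S (proj₁ minimal)
    open ClosedSet C
    exact = minimal-cut-exact G S minimal C
    E : Enum (cross G X) 2
    E = subst (Enum (cross G X))
      (trans (sum-cong λ (e : Fin m) → cong ⟦_⟧ (exact e)) (trans (sym (∣∣≡count S)) two))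
      (enum-count (cross G X))
    open Enum E
    e₁ = elem zero
    e₂ = elem (suc zero)
    e₁≢e₂ : e₁ ≢ e₂
    e₁≢e₂ p with elem-injective p
    ... | ()
    c₁ = elem-sound zero
    c₂ = elem-sound (suc zero)
    only : ∀ e → cross G X e ≡ true → e ≡ e₁ ⊎ e ≡ e₂
    only e ce with elem-complete e ce
    ... | zero , p = inj₁ (sym p)
    ... | suc zero , p = inj₂ (sym p)
    other = Side.splice-two G smaller reg (not ∘ X) y (cong not Xy) x (cong not Xx) e₁ e₂
      (trans (cross-not G X e₁) c₁) (trans (cross-not G X e₂) c₂) e₁≢e₂
      λ e ce → only e (trans (sym (cross-not G X e)) ce)

  record OneCut (X : Fin n → Bool) (e : Fin m) : Set where
    field
      crosses : cross G X e ≡ true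
      only : ∀ f → cross G X f ≡ true → f ≡ e

    count-1 : count (cross G X) ≡ 1
    count-1 = count-1-of-unique (cross G X) e crosses only

  oneCut-resp : ∀ {X Y e} → (∀ v → X v ≡ Y v) → OneCut X e → OneCut Y e
  oneCut-resp {X} {Y} {e} h O = record
    { crosses = trans (sym (cross-cong G h e)) crosses
    ; only = λ f cf → only f (trans (cross-cong G h f) cf) }
    where open OneCut O

  oneCut-not : ∀ {X e} → OneCut X e → OneCut (not ∘ X) e
  oneCut-not {X} {e} O = record
    { crosses = trans (cross-not G X e) crosses
    ; only = λ f cf → only f (trans (sym (cross-not G X f)) cf) }
    where open OneCut O

  -- The closed set only has its boundary inside the one-element cut; by `crossing-edge` that
  -- boundary is nonempty, hence consists of `e`.
  bridge-cut : ∀ e → Bridge G e → Σ (Fin n → Bool) λ X → OneCut X e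
    × Σ (Fin n) λ x → Σ (Fin n) λ y → X x ≡ true × X y ≡ false
  bridge-cut e (S , cut , one , e∈S) = X , record { crosses = ce ; only = λ f cf → only f (δ⊆S f cf) } , x , y , Xx , Xy
    where
    open ClosedSet (cut⇒closed-set G S cut)
    only : ∀ f → f ∈ S → f ≡ e
    only f f∈S = unique-of-count-1 (trans (sym (∣∣≡count S)) one) ([]=⇒lookup f∈S) ([]=⇒lookup e∈S)
    ce : cross G X e ≡ true
    ce with crossing-edge X x y Xx Xy
    ... | f , cf = subst (λ g → cross G X g ≡ true) (only f (δ⊆S f cf)) cf

  zero₁-large : ∀ {X e} → OneCut X e → ∀ x y z → X x ≡ true → X y ≡ false → X z ≡ false → z ≢ y → Zero₁ G X e
  zero₁-large {X} {e} O x y z Xx Xy Xz z≢y = zero₁ G X (proj₁ R) (proj₁ (proj₂ (proj₂ R))) e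
    where R = Side.contract G smaller reg X x Xx y Xy 2 (cong (4 +_) (OneCut.count-1 O)) z Xz z≢y

  pendant-colouring : (X : Fin n → Bool) → Fin m → ℕ
  pendant-colouring X f = if cross G X f then 0 else 1

  zero₁-single : ∀ {X e} → OneCut X e → ∀ x → (∀ v → X v ≡ (v == x)) → Zero₁ G X e
  zero₁-single {X} {e} O x single = c , good , cong (if_then 0 else 1) crosses
    where
    open OneCut O
    c = pendant-colouring X
    good : GoodOn G X c
    good v Xv rewrite ==-sound {u = v} {x} (trans (sym (single v)) Xv) = pendant-good G x (reg x)
      (OneCut.count-1 (oneCut-resp single O)) c
      (λ f cf → cong (if_then 0 else 1) (trans (cross-cong G single f) cf))
      (λ f lf → cong (if_then 0 else 1) (trans (cross-cong G single f) (loop⇒¬cross G x f lf)))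

  -- The vertices `y` and `z` record that `G` has at least three vertices, so that one lies apart
  -- from both ends of the bridge in `other-end`.
  record Pendant (x : Fin n) (e : Fin m) : Set where
    field
      cut : OneCut (_== x) e
      y z : Fin n
      y≢x : y ≢ x
      z≢x : z ≢ x
      z≢y : z ≢ y

  -- If both sides have further vertices, each is coloured after replacing the other by a vertex with
  -- two loops; if both sides are single vertices, G is coloured directly.
  bridge-pendant : ∀ e → Bridge G e → Σ (Fin n) λ x → Pendant x e
  bridge-pendant e bridge with bridge-cut e bridge
  ... | X , O , x , y , Xx , Xy
    with another-or-single X x Xx | another-or-single (not ∘ X) y (cong not Xy)
  ... | inj₁ (x′ , Xx′ , x′≢x) | inj₂ single =
          y , record { cut = oneCut-resp single (oneCut-not O) ; y = x ; z = x′
                     ; y≢x = λ { refl → true≢false Xx Xy } ; z≢x = λ { refl → true≢false Xx′ Xy } ; z≢y = x′≢x }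
  ... | inj₂ single | inj₁ (y′ , Yy′ , y′≢y) =
          x , record { cut = oneCut-resp single O ; y = y ; z = y′
                     ; y≢x = λ { refl → true≢false Xx Xy } ; z≢x = λ { refl → true≢false Xx (not-true Yy′) } ; z≢y = y′≢y }
  ... | inj₁ (x′ , Xx′ , x′≢x) | inj₁ (y′ , Yy′ , y′≢y) =
          ⊥-elim (uncolourable (glue G X (proj₁ sX) (proj₁ sY) n≥1 (proj₁ (proj₂ sX)) (proj₁ (proj₂ sY)) agree))
    where
    sX = zero₁-large O x y y′ Xx Xy (not-true Yy′) y′≢y
    sY = zero₁-large (oneCut-not O) y x x′ (cong not Xy) (cong not Xx) (cong not Xx′) x′≢x
    agree : ∀ f → cross G X f ≡ true → proj₁ sX f ≡ proj₁ sY f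
    agree f cf rewrite OneCut.only O f cf = trans (proj₂ (proj₂ sX)) (sym (proj₂ (proj₂ sY)))
  ... | inj₂ singleX | inj₂ singleY =
          ⊥-elim (uncolourable (glue G X (proj₁ sX) (proj₁ sY) n≥1 (proj₁ (proj₂ sX)) (proj₁ (proj₂ sY)) agree))
    where
    sX = zero₁-single O x singleX
    sY = zero₁-single (oneCut-not O) y singleY
    agree : ∀ f → cross G X f ≡ true → proj₁ sX f ≡ proj₁ sY f
    agree f cf rewrite OneCut.only O f cf = trans (proj₂ (proj₂ sX)) (sym (proj₂ (proj₂ sY)))

  pendant-two-loops : ∀ {x e} → Pendant x e → loops G x ≡ 2
  pendant-two-loops {x} P = *-cancelˡ-≡ _ _ 2 (suc-injective
    (trans (sym (trans (degree-single G x) (cong (_+ 2 * loops G x) (OneCut.count-1 (Pendant.cut P))))) (reg x)))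

  -- With two loops at `w`, only `e` would leave `w`, just as only `e` leaves `x`. Then nothing
  -- would leave `{x, w}`, although a third vertex exists.
  other-end : ∀ {x e} → Pendant x e → ∀ w → cross G (_== w) e ≡ true →
    cross G (λ v → v == x ∨ v == w) e ≡ false → loops G w ≢ 2
  other-end {x} {e} P w ew eZ two = true≢false (subst (λ g → cross G Z g ≡ true) f≡e cf) eZ
    where
    open Pendant P
    open OneCut cut
    Z : Fin n → Bool
    Z v = v == x ∨ v == w
    one : count (cross G (_== w)) ≡ 1
    one = +-cancelʳ-≡ 4 _ 1 (trans (cong (λ t → count (cross G (_== w)) + 2 * t) (sym two))
      (trans (sym (degree-single G w)) (reg w)))
    third : Σ (Fin n) λ v → v ≢ x × v ≢ w
    third with y ≟ w
    ... | yes refl = z , z≢x , z≢y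
    ... | no y≢w = y , y≢x , y≢w
    t = proj₁ third
    Zt : Z t ≡ false
    Zt = cong₂ _∨_ (dec-false (t ≟ x) (proj₁ (proj₂ third))) (dec-false (t ≟ w) (proj₂ (proj₂ third)))
    Zx : Z x ≡ true
    Zx = cong (_∨ x == w) (==-refl x)
    crossing = crossing-edge Z x t Zx Zt
    cf = proj₂ crossing
    f≡e : proj₁ crossing ≡ e
    f≡e with cross-∨ G (_== x) (_== w) (proj₁ crossing) cf
    ... | inj₁ fx = only _ fx
    ... | inj₂ fw = unique-of-count-1 one fw ew

  bridge-ends : ∀ e → Bridge G e →
    (loops G (src G e) ≡ 2 × loops G (tgt G e) ≢ 2) ⊎ (loops G (src G e) ≢ 2 × loops G (tgt G e) ≡ 2)
  bridge-ends e bridge with bridge-pendant e bridge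
  ... | x , P with xor-split {src G e == x} (OneCut.crosses (Pendant.cut P))
  ...   | inj₁ (p , q) = inj₁ (trans (cong (loops G) (==-sound p)) (pendant-two-loops P) ,
            other-end P (tgt G e) ends-cross ends-inside)
    where
    ends-cross : cross G (_== tgt G e) e ≡ true
    ends-cross rewrite ==-refl (tgt G e) | ==-sound {u = src G e} {x} p | ==-sym x (tgt G e) | q = refl
    ends-inside : cross G (λ v → v == x ∨ v == tgt G e) e ≡ false
    ends-inside rewrite p | ==-refl (tgt G e) | q = refl
  ...   | inj₂ (p , q) = inj₂ (other-end P (src G e) ends-cross ends-inside ,
            trans (cong (loops G) (==-sound q)) (pendant-two-loops P))
    where
    ends-cross : cross G (_== src G e) e ≡ true
    ends-cross rewrite ==-refl (src G e) | ==-sound {u = tgt G e} {x} q | ==-sym x (src G e) | p = refl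
    ends-inside : cross G (λ v → v == x ∨ v == src G e) e ≡ false
    ends-inside rewrite p | ==-refl (src G e) | q = refl

  -- Distinct bridges have distinct pendant vertices `x` and `x′`, and the boundary of `{x, x′}` is
  -- a 2-cut. Colouring the loops at both by 1 and the bridges by 0 gives that side equal colours on
  -- the cut, so `no-2-cut` applies.
  bridges-equal : ∀ e e′ → Bridge G e → Bridge G e′ → e ≡ e′
  bridges-equal e e′ bridge bridge′ with e ≟ e′
  ... | yes p = p
  ... | no e≢e′ with bridge-pendant e bridge | bridge-pendant e′ bridge′
  ...   | x , P | x′ , P′ = ⊥-elim
      (no-2-cut (not ∘ Y) (inner G (not ∘ Y) e) x (inner∈X G (not ∘ Y) e cXe) (cong not Yx) e e′ e≢e′ cXe cXe′ only
        (c , good , c0 e cYe , c0 e′ cYe′))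
    where
    module O = OneCut (Pendant.cut P)
    module O′ = OneCut (Pendant.cut P′)
    x≢x′ : x ≢ x′
    x≢x′ refl = e≢e′ (O′.only e O.crosses)
    Y : Fin n → Bool
    Y v = v == x ∨ v == x′
    Yx : Y x ≡ true
    Yx = cong (_∨ x == x′) (==-refl x)
    not-cross : ∀ {b} → (b ≡ true → ⊥) → b ≡ false
    not-cross {true} h = ⊥-elim (h refl)
    not-cross {false} h = refl
    cYe : cross G Y e ≡ true
    cYe = cross-single-∨ G x x′ e x≢x′ O.crosses (not-cross (e≢e′ ∘ O′.only e))
    cYe′ : cross G Y e′ ≡ true
    cYe′ = trans (cross-cong G (λ v → ∨-comm (v == x) (v == x′)) e′)
      (cross-single-∨ G x′ x e′ (x≢x′ ∘ sym) O′.crosses (not-cross (e≢e′ ∘ sym ∘ O.only e′)))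
    cXe = trans (cross-not G Y e) cYe
    cXe′ = trans (cross-not G Y e′) cYe′
    only : ∀ f → cross G (not ∘ Y) f ≡ true → f ≡ e ⊎ f ≡ e′
    only f cf with cross-∨ G (_== x) (_== x′) f (trans (sym (cross-not G Y f)) cf)
    ... | inj₁ p = inj₁ (O.only f p)
    ... | inj₂ p = inj₂ (O′.only f p)
    c = pendant-colouring Y
    c0 : ∀ f → cross G Y f ≡ true → c f ≡ 0
    c0 f cf = cong (if_then 0 else 1) cf
    c1 : ∀ w f → loop-at G w f ≡ true → c f ≡ 1
    c1 w f lf = cong (if_then 0 else 1) (not-cross λ cf → absurd cf)
      where
      absurd : cross G Y f ≡ true → ⊥
      absurd cf with src G f ≟ w | tgt G f ≟ w
      ... | yes p | yes q rewrite p | q with Y w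
      ...   | true = true≢false refl (sym cf)
      ...   | false = true≢false refl (sym cf)
    good : GoodOn G (not ∘ not ∘ Y) c
    good v YYv with ∨-split {v == x} (trans (sym (not-involutive (Y v))) YYv)
    ... | inj₁ p rewrite ==-sound {u = v} {x} p = pendant-good G x (reg x) O.count-1 c
            (λ f cf → trans (cong c (O.only f cf)) (c0 e cYe)) (c1 x)
    ... | inj₂ p rewrite ==-sound {u = v} {x′} p = pendant-good G x′ (reg x′) O′.count-1 c
            (λ f cf → trans (cong c (O′.only f cf)) (c0 e′ cYe′)) (c1 x′)

  -- The second vertex on each side lets both sides be coloured through reductions. Either both
  -- admit the constant pattern, or one admits all two-equal patterns and so matches the one that
  -- `some-two` provides on the other.
  no-large-3-cut : ∀ X x x′ y y′ → X x ≡ true → X x′ ≡ true → x′ ≢ x → X y ≡ false → X y′ ≡ false → y′ ≢ y →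
    ∀ {e₁ e₂ e₃} → ¬ Three (cross G X) e₁ e₂ e₃
  no-large-3-cut X x x′ y y′ Xx Xx′ x′≢x Xy Xy′ y′≢y {e₁} {e₂} {e₃} T =
    conclude TX.all-equal-or-every-two TY.all-equal-or-every-two TX.some-two TY.some-two
    where
    open Three T
    Y : Fin n → Bool
    Y = not ∘ X
    EveryTwo SomeTwo : (Fin n → Bool) → Set
    EveryTwo Z = ZeroZeroOne G Z e₁ e₂ e₃ × ZeroZeroOne G Z e₁ e₃ e₂ × ZeroZeroOne G Z e₂ e₃ e₁
    SomeTwo Z = ZeroZeroOne G Z e₁ e₂ e₃ ⊎ ZeroZeroOne G Z e₁ e₃ e₂ ⊎ ZeroZeroOne G Z e₂ e₃ e₁
    module TX = ThreeCut G smaller reg X x Xx y Xy y′ Xy′ y′≢y T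
    module TY = ThreeCut G smaller reg Y y (cong not Xy) x (cong not Xx) x′ (cong not Xx′) x′≢x
      (three-resp (cross-not G X) T)
    glue-at : ∀ cX cY → GoodOn G X cX → GoodOn G Y cY → cX e₁ ≡ cY e₁ → cX e₂ ≡ cY e₂ → cX e₃ ≡ cY e₃ → ⊥
    glue-at cX cY gX gY p₁ p₂ p₃ = uncolourable (glue G X cX cY n≥1 gX gY agree)
      where
      agree : ∀ e → cross G X e ≡ true → cX e ≡ cY e
      agree e ce with complete e ce
      ... | inj₁ refl = p₁
      ... | inj₂ (inj₁ refl) = p₂
      ... | inj₂ (inj₂ refl) = p₃
    glue₀ : Zero₃ G X e₁ e₂ e₃ → Zero₃ G Y e₁ e₂ e₃ → ⊥
    glue₀ (cX , gX , p₁ , p₂ , p₃) (cY , gY , r₁ , r₂ , r₃) =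
      glue-at cX cY gX gY (trans p₁ (sym r₁)) (trans p₂ (sym r₂)) (trans p₃ (sym r₃))
    glue₁ : ZeroZeroOne G X e₂ e₃ e₁ → ZeroZeroOne G Y e₂ e₃ e₁ → ⊥
    glue₁ (cX , gX , p₂ , p₃ , p₁) (cY , gY , r₂ , r₃ , r₁) =
      glue-at cX cY gX gY (trans p₁ (sym r₁)) (trans p₂ (sym r₂)) (trans p₃ (sym r₃))
    glue₂ : ZeroZeroOne G X e₁ e₃ e₂ → ZeroZeroOne G Y e₁ e₃ e₂ → ⊥
    glue₂ (cX , gX , p₁ , p₃ , p₂) (cY , gY , r₁ , r₃ , r₂) =
      glue-at cX cY gX gY (trans p₁ (sym r₁)) (trans p₂ (sym r₂)) (trans p₃ (sym r₃))
    glue₃ : ZeroZeroOne G X e₁ e₂ e₃ → ZeroZeroOne G Y e₁ e₂ e₃ → ⊥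
    glue₃ (cX , gX , p₁ , p₂ , p₃) (cY , gY , r₁ , r₂ , r₃) =
      glue-at cX cY gX gY (trans p₁ (sym r₁)) (trans p₂ (sym r₂)) (trans p₃ (sym r₃))
    conclude : Zero₃ G X e₁ e₂ e₃ ⊎ EveryTwo X → Zero₃ G Y e₁ e₂ e₃ ⊎ EveryTwo Y → SomeTwo X → SomeTwo Y → ⊥
    conclude (inj₁ s) (inj₁ s′) _ _ = glue₀ s s′
    conclude (inj₂ (t₃ , t₂ , t₁)) _ _ (inj₁ s) = glue₃ t₃ s
    conclude (inj₂ (t₃ , t₂ , t₁)) _ _ (inj₂ (inj₁ s)) = glue₂ t₂ s
    conclude (inj₂ (t₃ , t₂ , t₁)) _ _ (inj₂ (inj₂ s)) = glue₁ t₁ s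
    conclude (inj₁ _) (inj₂ (t₃ , t₂ , t₁)) (inj₁ s) _ = glue₃ s t₃
    conclude (inj₁ _) (inj₂ (t₃ , t₂ , t₁)) (inj₂ (inj₁ s)) _ = glue₂ s t₂
    conclude (inj₁ _) (inj₂ (t₃ , t₂ , t₁)) (inj₂ (inj₂ s)) _ = glue₁ s t₁

  -- By `no-large-3-cut` one side is a single vertex. Three of its five degrees go to the cut, so
  -- the remaining two form a loop.
  three-cut-at-vertex : ∀ S → MinimalEdgeCut G S → ∣ S ∣ ≡ 3 →
    Σ (Fin n) λ w → (∀ e → e ∈ S → EndOf G e w) × 1 ≤ loops G w
  three-cut-at-vertex S minimal size-3 =
    conclude (another-or-single X x Xx) (another-or-single (not ∘ X) y (cong not Xy))
    where
    C = cut⇒closed-set G S (proj₁ minimal)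
    open ClosedSet C
    exact : ∀ e → cross G X e ≡ lookup S e
    exact = minimal-cut-exact G S minimal C
    count-3 : count (cross G X) ≡ 3
    count-3 = trans (sum-cong λ (e : Fin m) → cong ⟦_⟧ (exact e)) (trans (sym (∣∣≡count S)) size-3)
    at-vertex : ∀ w → (∀ e → cross G (_== w) e ≡ cross G X e) →
      Σ (Fin n) λ w → (∀ e → e ∈ S → EndOf G e w) × 1 ≤ loops G w
    at-vertex w same = w , is-end , one-loop (loops G w) five
      where
      is-end : ∀ e → e ∈ S → EndOf G e w
      is-end e e∈S with xor-split {src G e == w} (trans (same e) (trans (exact e) ([]=⇒lookup e∈S)))
      ... | inj₁ (p , _) = inj₁ (==-sound p)
      ... | inj₂ (_ , p) = inj₂ (==-sound p)
      five : 3 + 2 * loops G w ≡ 5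
      five = trans (cong (_+ 2 * loops G w)
          (sym (trans (sum-cong λ (e : Fin m) → cong ⟦_⟧ (same e)) count-3)))
        (trans (sym (degree-single G w)) (reg w))
      one-loop : ∀ k → 3 + 2 * k ≡ 5 → 1 ≤ k
      one-loop (suc k) _ = s≤s z≤n
    conclude : ((Σ (Fin n) λ z → X z ≡ true × z ≢ x) ⊎ (∀ v → X v ≡ (v == x))) →
      ((Σ (Fin n) λ z → not (X z) ≡ true × z ≢ y) ⊎ (∀ v → not (X v) ≡ (v == y))) →
      Σ (Fin n) λ w → (∀ e → e ∈ S → EndOf G e w) × 1 ≤ loops G w
    conclude (inj₂ single) _ = at-vertex x λ e → sym (cross-cong G single e)
    conclude (inj₁ _) (inj₂ single) = at-vertex y λ e → trans (sym (cross-cong G single e)) (cross-not G X e)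
    conclude (inj₁ (x′ , Xx′ , x′≢x)) (inj₁ (y′ , Yy′ , y′≢y)) =
      ⊥-elim (no-large-3-cut X x x′ y y′ Xx Xx′ x′≢x Xy (not-true Yy′) y′≢y
        (three (subst (Enum (cross G X)) count-3 (enum-count (cross G X)))))

-- Counting facts and double negation for the matching argument

bool-ext : ∀ {a b : Bool} → (a ≡ true → b ≡ true) → (b ≡ true → a ≡ true) → a ≡ b
bool-ext {true} p q = sym (p refl)
bool-ext {false} {true} p q = q refl
bool-ext {false} {false} p q = refl

∧-split : ∀ {a b} → (a ∧ b) ≡ true → a ≡ true × b ≡ true
∧-split {true} p = refl , p

⟦∧⟧ : ∀ a b → ⟦ a ∧ b ⟧ ≡ ⟦ a ⟧ * ⟦ b ⟧
⟦∧⟧ true b = sym (*-identityˡ ⟦ b ⟧)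
⟦∧⟧ false b = refl

count-cong : ∀ {m} {q q′ : Fin m → Bool} → (∀ i → q i ≡ q′ i) → count q ≡ count q′
count-cong h = sum-cong (λ i → cong ⟦_⟧ (h i))

count-≤1 : ∀ {m} (q : Fin m → Bool) → (∀ i j → q i ≡ true → q j ≡ true → i ≡ j) → count q ≤ 1
count-≤1 {m} q unique with any? (λ i → q i Bool.≟ true)
... | yes (i , qi) = ≤-reflexive (count-1-of-unique q i qi (λ j qj → unique j i qj qi))
... | no none = ≤-trans (≤-reflexive (trans (sum-cong zeros) (sum-0 m))) z≤n
  where
  zeros : ∀ i → ⟦ q i ⟧ ≡ 0
  zeros i with q i in qi
  ... | true = ⊥-elim (none (i , qi))
  ... | false = refl

-- Double-negation shift over a finite index set, which permits classical case distinctions at all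
-- vertices simultaneously when the goal is `⊥`.
¬¬-∀ : ∀ {n} {P : Fin n → Set} → (∀ i → ¬ ¬ P i) → ¬ ¬ (∀ i → P i)
¬¬-∀ {zero} h k = k λ ()
¬¬-∀ {suc n} h k = h zero λ p → ¬¬-∀ (h ∘ suc) λ ps → k λ { zero → p ; (suc i) → ps i }

-- Involutions

lt : ∀ {n} → Fin n → Fin n → ℕ
lt u v = ⟦ does (u <? v) ⟧

lt-tri : ∀ {n} (u v : Fin n) → ⟦ u == v ⟧ + (lt u v + lt v u) ≡ 1
lt-tri u v with <-cmp u v
... | tri< p q r rewrite dec-false (u ≟ v) q | dec-true (u <? v) p | dec-false (v <? u) r = refl
... | tri≈ p q r rewrite dec-true (u ≟ v) q | dec-false (u <? v) p | dec-false (v <? u) r = refl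
... | tri> p q r rewrite dec-false (u ≟ v) q | dec-false (u <? v) p | dec-true (v <? u) r = refl

module _ {n} (f : Fin n → Fin n) (involutive : ∀ v → f (f v) ≡ v) where

  involution-== : ∀ u v → (u == f v) ≡ (v == f u)
  involution-== u v = does-⇔ (mk⇔ (λ p → trans (sym (involutive v)) (cong f (sym p)))
                                  (λ p → trans (sym (involutive u)) (cong f (sym p)))) (u ≟ f v) (v ≟ f u)

  sum-involution : ∀ (g : Fin n → ℕ) → sumFin (λ v → g (f v)) ≡ sumFin g
  sum-involution g = begin
    sumFin (λ v → g (f v))                              ≡⟨ (sum-cong λ (v : Fin n) → sum-δ (f v) g) ⟨
    sumFin (λ v → sumFin (λ u → ⟦ u == f v ⟧ * g u))    ≡⟨ sum-swap (λ v u → ⟦ u == f v ⟧ * g u) ⟩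
    sumFin (λ u → sumFin (λ v → ⟦ u == f v ⟧ * g u))    ≡⟨ (sum-cong λ (u : Fin n) → sum-cong λ (v : Fin n) →
                                                              cong (λ b → ⟦ b ⟧ * g u) (involution-== u v)) ⟩
    sumFin (λ u → sumFin (λ v → ⟦ v == f u ⟧ * g u))    ≡⟨ (sum-cong λ (u : Fin n) → sum-δ (f u) (λ _ → g u)) ⟩
    sumFin g                                            ∎
    where open ≡-Reasoning

  -- The two-element orbits in `C` are counted by `up` through their smaller elements; applying `f`
  -- shows that the larger elements are equally many.
  parity : ∀ C → (∀ v → C (f v) ≡ C v) →
    Σ ℕ λ k → count C ≡ count (λ v → C v ∧ f v == v) + 2 * k
  parity C inv = up , (begin
    count C
      ≡⟨ sum-cong split ⟩
    sumFin (λ v → ⟦ C v ∧ f v == v ⟧ + (⟦ C v ⟧ * lt (f v) v + ⟦ C v ⟧ * lt v (f v)))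
      ≡⟨ sum-+ {n} _ _ ⟩
    fix + sumFin (λ v → ⟦ C v ⟧ * lt (f v) v + ⟦ C v ⟧ * lt v (f v))
      ≡⟨ cong (fix +_) (sum-+ {n} _ _) ⟩
    fix + (sumFin (λ v → ⟦ C v ⟧ * lt (f v) v) + up)
      ≡⟨ cong (λ t → fix + (t + up)) down≡up ⟩
    fix + (up + up)
      ≡⟨ cong (λ t → fix + (up + t)) (+-identityʳ up) ⟨
    fix + 2 * up ∎)
    where
    open ≡-Reasoning
    fix up : ℕ
    fix = count (λ v → C v ∧ f v == v)
    up = sumFin (λ v → ⟦ C v ⟧ * lt v (f v))
    split : ∀ v → ⟦ C v ⟧ ≡ ⟦ C v ∧ f v == v ⟧ + (⟦ C v ⟧ * lt (f v) v + ⟦ C v ⟧ * lt v (f v))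
    split v with C v
    ... | false = refl
    ... | true = sym (trans (cong₂ (λ s t → ⟦ f v == v ⟧ + (s + t)) (*-identityˡ (lt (f v) v)) (*-identityˡ (lt v (f v))))
                       (lt-tri (f v) v))
    down≡up : sumFin (λ v → ⟦ C v ⟧ * lt (f v) v) ≡ up
    down≡up = trans (sym (sum-involution (λ v → ⟦ C v ⟧ * lt (f v) v)))
      (sum-cong λ (v : Fin n) → cong₂ (λ b w → ⟦ b ⟧ * lt w (f v)) (inv v) (involutive v))

-- Matchings, as involutions moving vertices along edges: fixed points are the vertices missed, and
-- matchings fixing U pointwise are those of G − U.

record Matching {n m} (G : Graph n m) : Set where
  field
    mate : Fin n → Fin n
    involutive : ∀ v → mate (mate v) ≡ v
    adjacent : ∀ v → mate v ≡ v ⊎ Σ (Fin m) λ e → Joins G e v (mate v)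

open Matching

module _ {n m} {G : Graph n m} where

  fixed : Matching G → ℕ
  fixed N = count (λ v → mate N v == v)

  disagreements : Matching G → Matching G → ℕ
  disagreements M N = count (λ v → not (mate M v == mate N v))

  Fixes : (Fin n → Bool) → Matching G → Set
  Fixes U N = ∀ v → U v ≡ true → mate N v ≡ v

  -- Fewest missed vertices means a maximum matching of `G − U`.
  Optimal : (Fin n → Bool) → Matching G → Set
  Optimal U N = Fixes U N × (∀ M → Fixes U M → fixed N ≤ fixed M)

  -- Gallai's relation "no maximum matching misses both", with the conclusion `u ≡ v` making it
  -- reflexive.
  Linked : (Fin n → Bool) → Fin n → Fin n → Set
  Linked U u v = ∀ N → Optimal U N → mate N u ≡ u → mate N v ≡ v → u ≡ v

  moved∉U : ∀ {U} N → Fixes U N → ∀ {v} → mate N v ≢ v → U v ≡ false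
  moved∉U {U} N fixes {v} p with U v in Uv
  ... | true = ⊥-elim (p (fixes v Uv))
  ... | false = refl

  mate-moved : ∀ (N : Matching G) {v} → mate N v ≢ v → mate N (mate N v) ≢ mate N v
  mate-moved N {v} p q = p (trans (sym q) (involutive N v))

  -- The edge `xy` is added and the edge of `N` at `y`, if any, removed. If `y` was missed, then `z`
  -- is `y` and the matching is augmented; otherwise `z` is missed in place of `x`.
  module Rematch (N : Matching G) (x y : Fin n) (Nx : mate N x ≡ x) (x≢y : x ≢ y)
    (joined : Σ (Fin m) λ e → Joins G e x y) where

    z : Fin n
    z = mate N y

    z≢x : z ≢ x
    z≢x p = x≢y (trans (sym Nx) (trans (cong (mate N) (sym p)) (involutive N y)))

    -- Since `z` may equal `y`, the case `at-z` excludes `y`, whose new partner `x` takes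
    -- precedence.
    data Place (w : Fin n) : Set where
      at-x : w ≡ x → Place w
      at-y : w ≡ y → Place w
      at-z : w ≡ z → w ≢ y → Place w
      elsewhere : w ≢ x → w ≢ y → w ≢ z → Place w

    place : ∀ w → Place w
    place w with w ≟ x | w ≟ y | w ≟ z
    ... | yes p | _ | _ = at-x p
    ... | no _ | yes p | _ = at-y p
    ... | no _ | no p | yes q = at-z q p
    ... | no p | no q | no r = elsewhere p q r

    f′ : ∀ {w} → Place w → Fin n
    f′ (at-x _) = y
    f′ (at-y _) = x
    f′ (at-z _ _) = z
    f′ {w} (elsewhere _ _ _) = mate N w

    f : Fin n → Fin n
    f w = f′ (place w)

    f-x : f x ≡ y
    f-x with place x
    ... | at-x _ = refl
    ... | at-y p = ⊥-elim (x≢y p)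
    ... | at-z p _ = ⊥-elim (z≢x (sym p))
    ... | elsewhere p _ _ = ⊥-elim (p refl)

    f-y : f y ≡ x
    f-y with place y
    ... | at-x p = ⊥-elim (x≢y (sym p))
    ... | at-y _ = refl
    ... | at-z _ p = ⊥-elim (p refl)
    ... | elsewhere _ p _ = ⊥-elim (p refl)

    f-z : z ≢ y → f z ≡ z
    f-z z≢y with place z
    ... | at-x p = ⊥-elim (z≢x p)
    ... | at-y p = ⊥-elim (z≢y p)
    ... | at-z _ _ = refl
    ... | elsewhere _ _ p = ⊥-elim (p refl)

    f-elsewhere : ∀ {w} → w ≢ x → w ≢ y → w ≢ z → f w ≡ mate N w
    f-elsewhere {w} p q r with place w
    ... | at-x s = ⊥-elim (p s)
    ... | at-y s = ⊥-elim (q s)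
    ... | at-z s _ = ⊥-elim (r s)
    ... | elsewhere _ _ _ = refl

    f-involutive : ∀ w → f (f w) ≡ w
    f-involutive w with place w
    ... | at-x refl = f-y
    ... | at-y refl = f-x
    ... | at-z refl p = f-z p
    ... | elsewhere p q r = trans (f-elsewhere
            (λ s → p (trans (sym (involutive N w)) (trans (cong (mate N) s) Nx)))
            (λ s → r (trans (sym (involutive N w)) (cong (mate N) s)))
            (λ s → q (trans (sym (involutive N w)) (trans (cong (mate N) s) (involutive N y)))))
          (involutive N w)

    f-adjacent : ∀ w → f w ≡ w ⊎ Σ (Fin m) λ e → Joins G e w (f w)
    f-adjacent w with place w
    ... | at-x refl = inj₂ joined
    ... | at-y refl = inj₂ (proj₁ joined , swap (proj₂ joined))
    ... | at-z p _ = inj₁ (sym p)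
    ... | elsewhere _ _ _ = adjacent N w

    rematched : Matching G
    rematched = record { mate = f ; involutive = f-involutive ; adjacent = f-adjacent }

    keeps-fixed : ∀ {w} → w ≢ x → w ≢ y → mate N w ≡ w → f w ≡ w
    keeps-fixed {w} p q r with place w
    ... | at-x s = ⊥-elim (p s)
    ... | at-y s = ⊥-elim (q s)
    ... | at-z s _ = sym s
    ... | elsewhere _ _ _ = r

    rematched-fixes : ∀ U → Fixes U N → U x ≡ false → U y ≡ false → Fixes U rematched
    rematched-fixes U fixes Ux Uy w Uw = keeps-fixed
      (λ { refl → true≢false Uw Ux }) (λ { refl → true≢false Uw Uy }) (fixes w Uw)

    private
      -- A termwise bound with one unit to spare at `x` gives a strict inequality of sums.
      sum-step : ∀ {k} {q r : Fin n → ℕ} → sumFin r ≡ k → (∀ w → q w + ⟦ w == x ⟧ ≤ r w) → sumFin q < k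
      sum-step {k} {q} {r} total h = begin-strict
        sumFin q                                  <⟨ n<1+n _ ⟩
        suc (sumFin q)                            ≡⟨ +-comm 1 (sumFin q) ⟩
        sumFin q + 1                              ≡⟨ cong (sumFin q +_) (sum-δ-1 x) ⟨
        sumFin q + sumFin (λ w → ⟦ w == x ⟧)      ≡⟨ sum-+ q (λ w → ⟦ w == x ⟧) ⟨
        sumFin (λ w → q w + ⟦ w == x ⟧)           ≤⟨ sum-mono h ⟩
        sumFin r                                  ≡⟨ total ⟩
        k                                         ∎
        where open ≤-Reasoning

    augments : z ≡ y → fixed rematched < fixed N
    augments z≡y = sum-step refl term
      where
      term : ∀ w → ⟦ f w == w ⟧ + ⟦ w == x ⟧ ≤ ⟦ mate N w == w ⟧
      term w with place w
      ... | at-x refl rewrite dec-false (y ≟ x) (x≢y ∘ sym) | ==-refl x | Nx | ==-refl x = ≤-refl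
      ... | at-y refl rewrite dec-false (x ≟ y) x≢y | dec-false (y ≟ x) (x≢y ∘ sym) = z≤n
      ... | at-z p q = ⊥-elim (q (trans p z≡y))
      ... | elsewhere p _ _ rewrite dec-false (w ≟ x) p = ≤-reflexive (+-identityʳ _)

    exchanges : z ≢ y → fixed rematched ≤ fixed N
    exchanges z≢y = ℕ.s≤s⁻¹ (sum-step total term)
      where
      -- The extra unit pays for `z`, which becomes missed; the unit saved at `x` compensates for
      -- it.
      total : sumFin (λ w → ⟦ mate N w == w ⟧ + ⟦ w == z ⟧) ≡ suc (fixed N)
      total = trans (sum-+ (λ w → ⟦ mate N w == w ⟧) (λ w → ⟦ w == z ⟧))
        (trans (cong (fixed N +_) (sum-δ-1 z)) (+-comm (fixed N) 1))
      term : ∀ w → ⟦ f w == w ⟧ + ⟦ w == x ⟧ ≤ ⟦ mate N w == w ⟧ + ⟦ w == z ⟧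
      term w with place w
      ... | at-x refl rewrite dec-false (y ≟ x) (x≢y ∘ sym) | ==-refl x | Nx | ==-refl x = s≤s z≤n
      ... | at-y refl rewrite dec-false (x ≟ y) x≢y | dec-false (y ≟ x) (x≢y ∘ sym) = z≤n
      ... | at-z refl _ rewrite ==-refl z | dec-false (z ≟ x) z≢x = m≤n+m 1 _
      ... | elsewhere p _ _ rewrite dec-false (w ≟ x) p | +-identityʳ ⟦ mate N w == w ⟧ = m≤m+n _ _

    -- At `x` a disagreement disappears. Only `z` could gain one, but `N` paired it with `y` while
    -- `M` pairs `y` with `x`, so `z` already disagreed.
    approaches : ∀ M → mate M x ≡ y → disagreements M rematched < disagreements M N
    approaches M Mx = sum-step refl term
      where
      My : mate M y ≡ x
      My = trans (cong (mate M) (sym Mx)) (involutive M x)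
      term : ∀ w → ⟦ not (mate M w == f w) ⟧ + ⟦ w == x ⟧ ≤ ⟦ not (mate M w == mate N w) ⟧
      term w with place w
      ... | at-x refl rewrite Mx | Nx | ==-refl y | ==-refl x | dec-false (y ≟ x) (x≢y ∘ sym) = ≤-refl
      ... | at-y refl rewrite My | ==-refl x | dec-false (y ≟ x) (x≢y ∘ sym) = z≤n
      ... | at-z refl _ rewrite involutive N y | dec-false (z ≟ x) z≢x
              | dec-false (mate M z ≟ y) (λ p → z≢x (trans (sym (involutive M z)) (trans (cong (mate M) p) My)))
              | +-identityʳ ⟦ not (mate M z == z) ⟧ = ⟦⟧≤1 _
      ... | elsewhere p _ _ rewrite dec-false (w ≟ x) p = ≤-reflexive (+-identityʳ _)

  -- An optimal matching missing two distinct adjacent vertices could be augmented by their edge.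
  linked-adjacent : ∀ U u v → U u ≡ false → U v ≡ false → (Σ (Fin m) λ e → Joins G e u v) → Linked U u v
  linked-adjacent U u v Uu Uv joined N (fixes , optimal) Nu Nv with u ≟ v
  ... | yes p = p
  ... | no u≢v = ⊥-elim (<⇒≱ (augments Nv) (optimal rematched (rematched-fixes U fixes Uu Uv)))
    where open Rematch N u v Nu u≢v joined

  linked-mate : ∀ U M → Fixes U M → ∀ x → mate M x ≢ x → Linked U x (mate M x)
  linked-mate U M fixes x Mx with adjacent M x
  ... | inj₁ p = ⊥-elim (Mx p)
  ... | inj₂ joined = linked-adjacent U x (mate M x) (moved∉U M fixes Mx)
          (moved∉U M fixes (mate-moved M {x} Mx)) joined

  -- Gallai's lemma.  If M misses u and v while N misses t, exchanging an edge of N for an edge of M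
  -- keeps N optimal and missing t, and brings it closer to M.
  linked-trans : ∀ U u t v → (Σ (Matching G) λ N → Optimal U N × mate N t ≡ t) →
    Linked U u t → Linked U t v → Linked U u v
  linked-trans U u t v (N₀ , optimal₀ , N₀t) u~t t~v M optM Mu Mv with u ≟ v
  ... | yes p = p
  ... | no u≢v = ⊥-elim (descend (suc (disagreements M N₀)) N₀ optimal₀ N₀t ≤-refl)
    where
    Mt : mate M t ≢ t
    Mt p = u≢v (trans (u~t M optM Mu p) (t~v M optM p Mv))

    -- `M` misses `u` and `v`, both covered by `N`. If `M` also missed everything that `N` misses
    -- apart from `t`, it would miss more vertices than `N`, against the optimality of `M`.
    candidate : ∀ N → Optimal U N → mate N t ≡ t → Σ (Fin n) λ x → mate N x ≡ x × mate M x ≢ x × x ≢ t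
    candidate N optN Nt with any? (λ x → (mate N x ≟ x) ×-dec (¬? (mate M x ≟ x) ×-dec ¬? (x ≟ t)))
    ... | yes p = p
    ... | no none = ⊥-elim (<⇒≱ fewer (proj₂ optM N (proj₁ optN)))
      where
      Nu : mate N u ≢ u
      Nu p = Mt (subst (λ w → mate M w ≡ w) (u~t N optN p Nt) Mu)
      Nv : mate N v ≢ v
      Nv p = Mt (subst (λ w → mate M w ≡ w) (sym (t~v N optN Nt p)) Mv)
      term : ∀ w → ⟦ mate N w == w ⟧ + (⟦ w == u ⟧ + ⟦ w == v ⟧) ≤ ⟦ mate M w == w ⟧ + ⟦ w == t ⟧
      term w with w ≟ u | w ≟ v
      ... | yes p | yes q = ⊥-elim (u≢v (trans (sym p) q))
      ... | yes refl | no _ rewrite dec-false (mate N u ≟ u) Nu | dec-true (mate M u ≟ u) Mu = s≤s z≤n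
      ... | no _ | yes refl rewrite dec-false (mate N v ≟ v) Nv | dec-true (mate M v ≟ v) Mv = s≤s z≤n
      ... | no _ | no _ with mate N w ≟ w | mate M w ≟ w | w ≟ t
      ...   | no _ | _ | _ = z≤n
      ...   | yes _ | yes _ | _ = s≤s z≤n
      ...   | yes _ | no _ | yes _ = s≤s z≤n
      ...   | yes p | no q | no r = ⊥-elim (none (w , p , q , r))
      fewer : fixed N < fixed M
      fewer = +-cancelʳ-≤ 1 (suc (fixed N)) (fixed M) (begin
        suc (fixed N) + 1
          ≡⟨ +-assoc 1 (fixed N) 1 ⟩
        suc (fixed N + 1)
          ≡⟨ +-suc (fixed N) 1 ⟨
        fixed N + 2
          ≡⟨ cong₂ (λ s t → fixed N + (s + t)) (sum-δ-1 u) (sum-δ-1 v) ⟨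
        fixed N + (sumFin (λ w → ⟦ w == u ⟧) + sumFin (λ w → ⟦ w == v ⟧))
          ≡⟨ cong (fixed N +_) (sum-+ (λ w → ⟦ w == u ⟧) (λ w → ⟦ w == v ⟧)) ⟨
        fixed N + sumFin (λ w → ⟦ w == u ⟧ + ⟦ w == v ⟧)
          ≡⟨ sum-+ (λ w → ⟦ mate N w == w ⟧) (λ w → ⟦ w == u ⟧ + ⟦ w == v ⟧) ⟨
        sumFin (λ w → ⟦ mate N w == w ⟧ + (⟦ w == u ⟧ + ⟦ w == v ⟧))
          ≤⟨ sum-mono term ⟩
        sumFin (λ w → ⟦ mate M w == w ⟧ + ⟦ w == t ⟧)
          ≡⟨ sum-+ (λ w → ⟦ mate M w == w ⟧) (λ w → ⟦ w == t ⟧) ⟩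
        fixed M + sumFin (λ w → ⟦ w == t ⟧)
          ≡⟨ cong (fixed M +_) (sum-δ-1 t) ⟩
        fixed M + 1 ∎)
        where open ≤-Reasoning

    descend : ∀ k N → Optimal U N → mate N t ≡ t → disagreements M N < k → ⊥
    descend (suc k) N optN Nt (s≤s bound) with candidate N optN Nt
    ... | x , Nx , Mx , x≢t with adjacent M x
    ...   | inj₁ p = Mx p
    ...   | inj₂ joined = descend k rematched
              (rematched-fixes U (proj₁ optN) (moved∉U M (proj₁ optM) Mx) (moved∉U M (proj₁ optM) (mate-moved M {x} Mx)) ,
               λ N′ fixes → ≤-trans (exchanges Ny) (proj₂ optN N′ fixes))
              (keeps-fixed (x≢t ∘ sym) (λ { refl → Ny Nt }) Nt)
              (<-≤-trans (approaches M refl) bound)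
      where
      open Rematch N x (mate M x) Nx (Mx ∘ sym) joined
      -- If `N` missed the `M`-partner of `x` too, their edge would augment `N`. So the rematching
      -- is an exchange, and it leaves `t` missed.
      Ny : mate N (mate M x) ≢ mate M x
      Ny p = Mx (sym (linked-mate U M (proj₁ optM) x Mx N optN Nx p))

-- Degree sums

sum-ind : ∀ {n} (a : Fin n) (g : Fin n → ℕ) → sumFin (λ v → g v * ⟦ a == v ⟧) ≡ g a
sum-ind {n} a g = trans
  (sum-cong λ (v : Fin n) → trans (*-comm (g v) _) (cong (λ b → ⟦ b ⟧ * g v) (==-sym a v))) (sum-δ a g)

sum-degrees : ∀ {n m} (G : Graph n m) (C : Fin n → Bool) →
  sumFin (λ v → ⟦ C v ⟧ * degree G v) ≡ sumFin (λ e → ⟦ C (src G e) ⟧ + ⟦ C (tgt G e) ⟧)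
sum-degrees {n} {m} G C = begin
  sumFin (λ v → ⟦ C v ⟧ * degree G v)
    ≡⟨ (sum-cong λ (v : Fin n) → sym (sum-*ˡ ⟦ C v ⟧ (λ e → mult v (ends G e)))) ⟩
  sumFin (λ v → sumFin (λ e → ⟦ C v ⟧ * mult v (ends G e)))
    ≡⟨ sum-swap (λ v e → ⟦ C v ⟧ * mult v (ends G e)) ⟩
  sumFin (λ e → sumFin (λ v → ⟦ C v ⟧ * mult v (ends G e)))
    ≡⟨ sum-cong ends-in-C ⟩
  sumFin (λ e → ⟦ C (src G e) ⟧ + ⟦ C (tgt G e) ⟧) ∎
  where
  open ≡-Reasoning
  ends-in-C : ∀ e → sumFin (λ v → ⟦ C v ⟧ * mult v (ends G e)) ≡ ⟦ C (src G e) ⟧ + ⟦ C (tgt G e) ⟧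
  ends-in-C e = begin
    sumFin (λ v → ⟦ C v ⟧ * mult v (ends G e))
      ≡⟨ (sum-cong λ (v : Fin n) → trans (cong (⟦ C v ⟧ *_) (mult-ind v (src G e) (tgt G e)))
           (*-distribˡ-+ ⟦ C v ⟧ ⟦ src G e == v ⟧ ⟦ tgt G e == v ⟧)) ⟩
    sumFin (λ v → ⟦ C v ⟧ * ⟦ src G e == v ⟧ + ⟦ C v ⟧ * ⟦ tgt G e == v ⟧)
      ≡⟨ sum-+ {n} _ _ ⟩
    sumFin (λ v → ⟦ C v ⟧ * ⟦ src G e == v ⟧) + sumFin (λ v → ⟦ C v ⟧ * ⟦ tgt G e == v ⟧)
      ≡⟨ cong₂ _+_ (sum-ind (src G e) (⟦_⟧ ∘ C)) (sum-ind (tgt G e) (⟦_⟧ ∘ C)) ⟩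
    ⟦ C (src G e) ⟧ + ⟦ C (tgt G e) ⟧ ∎

module _ {n m} (G : Graph n m) (reg : Regular 5 G) where

  sum-degrees-regular : ∀ C → 5 * count C ≡ sumFin (λ e → ⟦ C (src G e) ⟧ + ⟦ C (tgt G e) ⟧)
  sum-degrees-regular C = trans (sym (sum-*ˡ {n} 5 (⟦_⟧ ∘ C))) (trans
    (sum-cong λ (v : Fin n) → trans (*-comm 5 ⟦ C v ⟧) (cong (⟦ C v ⟧ *_) (sym (reg v)))) (sum-degrees G C))

  cut-size : ∀ C → 5 * count C ≡ count (cross G C) + 2 * count (λ e → C (src G e) ∧ C (tgt G e))
  cut-size C = trans (sum-degrees-regular C) (trans (sum-cong term) (trans
    (sum-+ {m} _ _) (cong (count (cross G C) +_) (sum-*ˡ {m} 2 _))))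
    where
    term : ∀ e → ⟦ C (src G e) ⟧ + ⟦ C (tgt G e) ⟧ ≡ ⟦ cross G C e ⟧ + 2 * ⟦ C (src G e) ∧ C (tgt G e) ⟧
    term e with C (src G e) | C (tgt G e)
    ... | true | true = refl
    ... | true | false = refl
    ... | false | true = refl
    ... | false | false = refl

  -- The degrees in an odd set sum to an odd number, and edges inside it contribute evenly, so the
  -- cut is odd.
  odd-cut≥5 : ∀ C k → count C ≡ 1 + 2 * k → count (cross G C) ≢ 1 → count (cross G C) ≢ 3 → 5 ≤ count (cross G C)
  odd-cut≥5 C k odd ≢1 ≢3 = go (count (cross G C)) (count (λ e → C (src G e) ∧ C (tgt G e))) ≢1 ≢3 (trans (sym (cut-size C)) (cong (5 *_) odd))
    where
    double : ∀ k → 5 * (1 + 2 * k) ≡ suc (2 * (2 + 5 * k))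
    double = solve-∀
    even : ∀ j i → 2 * j + 2 * i ≡ 5 * (1 + 2 * k) → ⊥
    even j i p = even≢odd (j + i) (2 + 5 * k) (trans (*-distribˡ-+ 2 j i) (trans p (double k)))
    go : ∀ d i → d ≢ 1 → d ≢ 3 → d + 2 * i ≡ 5 * (1 + 2 * k) → 5 ≤ d
    go 0 i _ _ p = ⊥-elim (even 0 i p)
    go 1 i ≢1 _ p = ⊥-elim (≢1 refl)
    go 2 i _ _ p = ⊥-elim (even 1 i p)
    go 3 i _ ≢3 p = ⊥-elim (≢3 refl)
    go 4 i _ _ p = ⊥-elim (even 2 i p)
    go (suc (suc (suc (suc (suc d))))) i _ _ p = s≤s (s≤s (s≤s (s≤s (s≤s z≤n))))

  -- From `5 n = 2 m`; enough edges must exist to enlarge a bridge to a cut of exactly three edges.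
  edges≥3 : 1 ≤ n → 3 ≤ m
  edges≥3 n≥1 = go m (≤-trans (*-monoʳ-≤ 5 n≥1) (≤-reflexive (trans (cong (5 *_) (sym (sum-1 n)))
      (trans (sum-degrees-regular (λ _ → true)) (trans (sum-*ˡ {m} 2 (λ _ → 1)) (cong (2 *_) (sum-1 m)))))))
    where
    go : ∀ m → 5 ≤ 2 * m → 3 ≤ m
    go 1 (s≤s (s≤s ()))
    go 2 (s≤s (s≤s (s≤s (s≤s ()))))
    go (suc (suc (suc m))) _ = s≤s (s≤s (s≤s z≤n))

-- Perfect matchings give colourings

mult-joins : ∀ {n m} (G : Graph n m) e {u w} v → Joins G e u w → mult v (ends G e) ≡ ⟦ u == v ⟧ + ⟦ w == v ⟧
mult-joins G e {u} {w} v (inj₁ p) = trans (cong (mult v) p) (mult-ind v u w)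
mult-joins G e {u} {w} v (inj₂ p) = trans (cong (mult v) p) (trans (mult-ind v w u) (+-comm ⟦ w == v ⟧ ⟦ u == v ⟧))

module _ {n m} (G : Graph n m) (reg : Regular 5 G) (N : Matching G) (perfect : fixed N ≡ 0) where

  private
    moved : ∀ v → mate N v ≢ v
    moved v p = <⇒≱ (subst (λ b → 0 < ⟦ b ⟧) (sym (dec-true (mate N v ≟ v) p)) (s≤s z≤n))
      (≤-trans (term≤sum (λ v → ⟦ mate N v == v ⟧) v) (≤-reflexive perfect))

    joining : ∀ v → Σ (Fin m) λ e → Joins G e v (mate N v)
    joining v with adjacent N v
    ... | inj₁ p = ⊥-elim (moved v p)
    ... | inj₂ j = j

    pick : Fin n → Fin m
    pick v = proj₁ (joining v)

    up : Fin n → ℕ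
    up u = lt u (mate N u)

    -- An edge may be picked by both of its ends; only the pick of the smaller end counts.
    colour : Fin m → ℕ
    colour e = sumFin (λ u → up u * ⟦ e == pick u ⟧)

    up-once : ∀ v → up v + up (mate N v) ≡ 1
    up-once v rewrite involutive N v =
      trans (cong (λ b → ⟦ b ⟧ + (lt v (mate N v) + lt (mate N v) v)) (sym (dec-false (v ≟ mate N v) (moved v ∘ sym))))
        (lt-tri v (mate N v))

    -- The only picks meeting `v` are its own and that of its mate, and exactly one of the two is
    -- made by the smaller end.
    matched-once : ∀ v → wdeg G colour v ≡ 1
    matched-once v = begin
      sumFin (λ e → colour e * mult v (ends G e))
        ≡⟨ (sum-cong λ (e : Fin m) → trans (*-comm (colour e) _) (sym (sum-*ˡ {n} (mult v (ends G e)) _))) ⟩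
      sumFin (λ e → sumFin (λ u → mult v (ends G e) * (up u * ⟦ e == pick u ⟧)))
        ≡⟨ sum-swap (λ e u → mult v (ends G e) * (up u * ⟦ e == pick u ⟧)) ⟩
      sumFin (λ u → sumFin (λ e → mult v (ends G e) * (up u * ⟦ e == pick u ⟧)))
        ≡⟨ (sum-cong λ (u : Fin n) → trans
             (sum-cong λ (e : Fin m) → rotate (mult v (ends G e)) (up u) ⟦ e == pick u ⟧)
             (sum-δ (pick u) (λ e → up u * mult v (ends G e)))) ⟩
      sumFin (λ u → up u * mult v (ends G (pick u)))
        ≡⟨ (sum-cong λ (u : Fin n) → trans
             (cong (up u *_) (mult-joins G (pick u) v (proj₂ (joining u))))
             (expand u)) ⟩
      sumFin (λ u → ⟦ u == v ⟧ * up u + ⟦ u == mate N v ⟧ * up u)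
        ≡⟨ sum-+ {n} _ _ ⟩
      sumFin (λ u → ⟦ u == v ⟧ * up u) + sumFin (λ u → ⟦ u == mate N v ⟧ * up u)
        ≡⟨ cong₂ _+_ (sum-δ v up) (sum-δ (mate N v) up) ⟩
      up v + up (mate N v)
        ≡⟨ up-once v ⟩
      1 ∎
      where
      open ≡-Reasoning
      rotate : ∀ a b c → a * (b * c) ≡ c * (b * a)
      rotate = solve-∀
      distrib : ∀ a b c → a * (b + c) ≡ b * a + c * a
      distrib = solve-∀
      expand : ∀ u → up u * (⟦ u == v ⟧ + ⟦ mate N u == v ⟧) ≡ ⟦ u == v ⟧ * up u + ⟦ u == mate N v ⟧ * up u
      expand u = trans (distrib (up u) ⟦ u == v ⟧ ⟦ mate N u == v ⟧)
        (cong (λ b → ⟦ u == v ⟧ * up u + ⟦ b ⟧ * up u)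
          (trans (==-sym (mate N u) v) (involution-== (mate N) (involutive N) v u)))

    term≤1 : ∀ v e → colour e * mult v (ends G e) ≤ 1
    term≤1 v e = ≤-trans (term≤sum (λ e → colour e * mult v (ends G e)) e) (≤-reflexive (matched-once v))

    -- `s` is a colour and `k` a multiplicity at `v`. A colour is a priori any count, but the bound
    -- from `matched-once` forces 0 or 1 on every edge that meets `v`.
    is-one : ∀ s k → s * k ≤ 1 → is 1 s * k ≡ s * k
    is-one 0 k _ = refl
    is-one 1 k _ = refl
    is-one (suc (suc s)) zero _ = sym (*-zeroʳ s)
    is-one (suc (suc s)) (suc k) (s≤s p) = ⊥-elim (<⇒≱ (s≤s z≤n) (≤-trans (m≤n+m _ k) p))

    is-zero : ∀ s k → s * k ≤ 1 → is 0 s * k + s * k ≡ k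
    is-zero 0 k _ = trans (+-identityʳ _) (+-identityʳ k)
    is-zero 1 k _ = +-identityʳ k
    is-zero (suc (suc s)) zero _ = *-zeroʳ s
    is-zero (suc (suc s)) (suc k) (s≤s p) = ⊥-elim (<⇒≱ (s≤s z≤n) (≤-trans (m≤n+m _ k) p))

    good : ∀ v → GoodAt G colour v
    good v = 0 , 1 , (λ ()) , four , one
      where
      one : wdeg G (is 1 ∘ colour) v ≡ 1
      one = trans (sum-cong λ (e : Fin m) → is-one (colour e) _ (term≤1 v e)) (matched-once v)
      four : wdeg G (is 0 ∘ colour) v ≡ 4
      four = +-cancelʳ-≡ 1 _ 4 (trans (cong (wdeg G (is 0 ∘ colour) v +_) (sym (matched-once v)))
        (trans (sym (sum-+ {m} _ _)) (trans (sum-cong λ (e : Fin m) → is-zero (colour e) _ (term≤1 v e)) (reg v))))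

  perfect-matching-colours : 1 ≤ n → Has41Coloring G
  perfect-matching-colours n≥1 = has-colouring G n≥1 colour good

-- Tutte's condition

module Barrier {n m} (G : Graph n m) (reg : Regular 5 G)
  (odd≥5 : ∀ C k → count C ≡ 1 + 2 * k → 5 ≤ count (cross G C)) where

  identity : Matching G
  identity = record { mate = id ; involutive = λ _ → refl ; adjacent = λ _ → inj₁ refl }

  -- Descent on the number of missed vertices, starting from the empty matching `identity`.
  optimal-exists : ∀ U → ¬ ¬ Σ (Matching G) (Optimal U)
  optimal-exists U none = descend (suc (fixed identity)) identity (λ _ _ → refl) ≤-refl
    where
    descend : ∀ k N → Fixes U N → fixed N < k → ⊥
    descend (suc k) N fixes (s≤s bound) = none (N , fixes , minimal)
      where
      minimal : ∀ M → Fixes U M → fixed N ≤ fixed M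
      minimal M fixesM with fixed N ≤? fixed M
      ... | yes p = p
      ... | no p = ⊥-elim (descend k M fixesM (<-≤-trans (≰⇒> p) bound))

  -- The final stage: every vertex outside `U` is missed by some optimal matching, so Gallai's lemma
  -- makes `Linked` an equivalence relation there.
  module Saturated (U : Fin n → Bool) (N : Matching G) (optN : Optimal U N) (deficient : 2 * count U < fixed N)
    (missed : ∀ v → U v ≡ false → Σ (Matching G) λ M → Optimal U M × mate M v ≡ v)
    (linked? : ∀ u v → Dec (Linked {G = G} U u v)) where

    -- As `N` misses all roots, distinct ones are never linked, and they represent different
    -- classes.
    root : Fin n → Bool
    root r = not (U r) ∧ mate N r == r

    class : Fin n → Fin n → Bool
    class r v = not (U v) ∧ does (linked? v r)

    class-∉U : ∀ {r v} → class r v ≡ true → U v ≡ false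
    class-∉U {r} {v} p = not-true (proj₁ (∧-split {not (U v)} p))

    class-linked : ∀ {r v} → class r v ≡ true → Linked {G = G} U v r
    class-linked {r} {v} p with linked? v r | proj₂ (∧-split {not (U v)} p)
    ... | yes l | _ = l

    class-intro : ∀ {r v} → U v ≡ false → Linked {G = G} U v r → class r v ≡ true
    class-intro {r} {v} Uv l = cong₂ _∧_ (cong not Uv) (dec-true (linked? v r) l)

    class-step : ∀ r {u v} → U u ≡ false → Linked {G = G} U u v → class r v ≡ true → class r u ≡ true
    class-step r {u} {v} Uu l p = class-intro Uu (linked-trans U u v r (missed v (class-∉U {r} p)) l (class-linked p))

    linked-sym : ∀ {u v} → Linked {G = G} U u v → Linked {G = G} U v u
    linked-sym l M opt p q = sym (l M opt q p)

    class-mate : ∀ r v → class r v ≡ true → class r (mate N v) ≡ true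
    class-mate r v p with mate N v ≟ v
    ... | yes q = subst (λ w → class r w ≡ true) (sym q) p
    ... | no q = class-step r (moved∉U N (proj₁ optN) {mate N v} (mate-moved N {v} q))
                   (linked-sym (linked-mate U N (proj₁ optN) v q)) p

    class-invariant : ∀ r v → class r (mate N v) ≡ class r v
    class-invariant r v = bool-ext
      (λ p → subst (λ w → class r w ≡ true) (involutive N v) (class-mate r (mate N v) p)) (class-mate r v)

    root-∉U : ∀ {r} → root r ≡ true → U r ≡ false
    root-∉U {r} p = not-true (proj₁ (∧-split {not (U r)} p))

    root-fixed : ∀ {r} → root r ≡ true → mate N r ≡ r
    root-fixed {r} p = ==-sound (proj₂ (∧-split {not (U r)} p))

    -- The class is closed under the mates of `N`, whose only fixed point in it is `r`.
    class-odd : ∀ r → root r ≡ true → Σ ℕ λ k → count (class r) ≡ 1 + 2 * k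
    class-odd r Rr with parity (mate N) (involutive N) (class r) (class-invariant r)
    ... | k , p = k , trans p (cong (_+ 2 * k) (count-1-of-unique (λ v → class r v ∧ mate N v == v) r
            (cong₂ _∧_ (class-intro (root-∉U {r} Rr) (λ _ _ _ _ → refl)) (dec-true (mate N r ≟ r) (root-fixed {r} Rr)))
            λ v q → class-linked {r} {v} (proj₁ (∧-split q)) N optN
              (==-sound (proj₂ (∧-split {class r v} q))) (root-fixed {r} Rr)))

    one-class : ∀ v → count (λ r → root r ∧ class r v) ≤ 1
    one-class v = count-≤1 _ λ r r′ p q →
      let Rr , Cr = ∧-split {root r} p
          Rr′ , Cr′ = ∧-split {root r′} q
      in linked-trans U r v r′ (missed v (class-∉U {r} Cr)) (linked-sym (class-linked Cr)) (class-linked Cr′)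
           N optN (root-fixed {r} Rr) (root-fixed {r′} Rr′)

    U-∉class : ∀ r {v} → U v ≡ true → class r v ≡ false
    U-∉class r {v} Uv = cong (λ b → not b ∧ does (linked? v r)) Uv

    -- An edge outside `U` joins linked vertices and one within `U` meets no class, so neither
    -- crosses any. An edge with one end in `U` crosses at most the class of its other end.
    edge-bound : ∀ e → sumFin (λ r → ⟦ root r ⟧ * ⟦ cross G (class r) e ⟧) ≤ ⟦ U (src G e) ⟧ + ⟦ U (tgt G e) ⟧
    edge-bound e = bound (U (src G e)) (U (tgt G e)) refl refl
      where
      none : (∀ r → cross G (class r) e ≡ false) → sumFin (λ r → ⟦ root r ⟧ * ⟦ cross G (class r) e ⟧) ≡ 0
      none h = trans (sum-cong λ (r : Fin n) → trans (cong (λ b → ⟦ root r ⟧ * ⟦ b ⟧) (h r)) (*-zeroʳ ⟦ root r ⟧)) (sum-0 n)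
      one : ∀ v → (∀ r → cross G (class r) e ≡ class r v) → sumFin (λ r → ⟦ root r ⟧ * ⟦ cross G (class r) e ⟧) ≤ 1
      one v h = ≤-trans (≤-reflexive (sum-cong λ (r : Fin n) →
        trans (cong (λ b → ⟦ root r ⟧ * ⟦ b ⟧) (h r)) (sym (⟦∧⟧ (root r) (class r v))))) (one-class v)
      bound : ∀ s t → U (src G e) ≡ s → U (tgt G e) ≡ t →
        sumFin (λ r → ⟦ root r ⟧ * ⟦ cross G (class r) e ⟧) ≤ ⟦ s ⟧ + ⟦ t ⟧
      bound true true Ua Ub = ≤-trans (≤-reflexive (none λ r → cong₂ _xor_ (U-∉class r Ua) (U-∉class r Ub))) z≤n
      bound true false Ua Ub = one (tgt G e) λ r → cong (_xor class r (tgt G e)) (U-∉class r Ua)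
      bound false true Ua Ub = one (src G e) λ r →
        trans (cong (class r (src G e) xor_) (U-∉class r Ub)) (xor-identityʳ (class r (src G e)))
      bound false false Ua Ub = ≤-reflexive (none λ r → trans
        (cong (_xor class r (tgt G e)) (bool-ext (class-step r Ub (linked-sym linked)) (class-step r Ua linked)))
        (xor-same (class r (tgt G e))))
        where
        linked : Linked {G = G} U (src G e) (tgt G e)
        linked = linked-adjacent U (src G e) (tgt G e) Ua Ub (e , inj₁ refl)

    -- Double counting the edges between classes and `U`: each root's class sends at least 5, and
    -- each vertex of `U` can receive at most 5.
    roots≤U : count root ≤ count U
    roots≤U = *-cancelˡ-≤ 5 (begin
      5 * count root
        ≡⟨ sum-*ˡ {n} 5 (⟦_⟧ ∘ root) ⟨
      sumFin (λ r → 5 * ⟦ root r ⟧)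
        ≤⟨ sum-mono large ⟩
      sumFin (λ r → ⟦ root r ⟧ * count (cross G (class r)))
        ≡⟨ (sum-cong λ (r : Fin n) → sym (sum-*ˡ {m} ⟦ root r ⟧ _)) ⟩
      sumFin (λ r → sumFin (λ e → ⟦ root r ⟧ * ⟦ cross G (class r) e ⟧))
        ≡⟨ sum-swap (λ r e → ⟦ root r ⟧ * ⟦ cross G (class r) e ⟧) ⟩
      sumFin (λ e → sumFin (λ r → ⟦ root r ⟧ * ⟦ cross G (class r) e ⟧))
        ≤⟨ sum-mono edge-bound ⟩
      sumFin (λ e → ⟦ U (src G e) ⟧ + ⟦ U (tgt G e) ⟧)
        ≡⟨ sum-degrees-regular G reg U ⟨
      5 * count U ∎)
      where
      open ≤-Reasoning
      large : ∀ r → 5 * ⟦ root r ⟧ ≤ ⟦ root r ⟧ * count (cross G (class r))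
      large r with root r in Rr
      ... | false = z≤n
      ... | true = ≤-trans (odd≥5 (class r) (proj₁ (class-odd r Rr)) (proj₂ (class-odd r Rr))) (m≤m+n _ 0)

    fixed-split : fixed N ≡ count root + count U
    fixed-split = trans (sum-cong term) (sum-+ {n} _ _)
      where
      term : ∀ v → ⟦ mate N v == v ⟧ ≡ ⟦ root v ⟧ + ⟦ U v ⟧
      term v with U v in Uv
      ... | true = cong ⟦_⟧ (dec-true (mate N v ≟ v) (proj₁ optN v Uv))
      ... | false = sym (+-identityʳ _)

    -- `N` misses exactly the roots and `U`, hence at most twice as many vertices as `U` has,
    -- against `deficient`.
    absurd : ⊥
    absurd = <⇒≱ deficient (≤-trans (≤-reflexive fixed-split) (≤-trans (+-monoˡ-≤ (count U) roots≤U)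
      (≤-reflexive (cong (count U +_) (sym (+-identityʳ (count U)))))))

  all-fixed-parity : ∀ (N : Matching G) → Σ ℕ λ k → n ≡ fixed N + 2 * k
  all-fixed-parity N with parity (mate N) (involutive N) (λ _ → true) (λ _ → refl)
  ... | k , p = k , trans (sym (sum-1 n)) p

  same-parity-gap : ∀ {p q a b} → p + 2 * a ≡ q + 2 * b → p < q → 2 + p ≤ q
  same-parity-gap {p} {q} {a} {b} eq p<q with m≤n⇒m<n∨m≡n p<q
  ... | inj₁ lt = lt
  ... | inj₂ refl = ⊥-elim (even≢odd a b (+-cancelˡ-≡ p _ _ (trans eq (sym (+-suc p (2 * b))))))

  -- A matching that also misses `v` is not optimal for `U`, and by parity it misses at least two
  -- more vertices than `N`. This pays for the increase of `2 * count U` by two.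
  extend-barrier : ∀ U N → Optimal U N → 2 * count U < fixed N → ∀ v → U v ≡ false →
    (∀ M → Optimal U M → mate M v ≢ v) → let U′ = λ w → U w ∨ w == v in
    count U′ ≡ suc (count U) × (∀ M → Fixes U′ M → 2 * count U′ < fixed M)
  extend-barrier U N optN deficient v Uv moved = size , bound
    where
    U′ : Fin n → Bool
    U′ w = U w ∨ w == v
    term : ∀ w → ⟦ U′ w ⟧ ≡ ⟦ U w ⟧ + ⟦ w == v ⟧
    term w with w ≟ v
    ... | yes refl rewrite Uv = refl
    ... | no _ with U w
    ...   | true = refl
    ...   | false = refl
    size : count U′ ≡ suc (count U)
    size = trans (sum-cong term) (trans (sum-+ {n} _ _) (trans (cong (count U +_) (sum-δ-1 v)) (+-comm (count U) 1)))
    bound : ∀ M → Fixes U′ M → 2 * count U′ < fixed M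
    bound M fixes = begin-strict
      2 * count U′           ≡⟨ cong (2 *_) size ⟩
      2 * suc (count U)      ≡⟨ *-distribˡ-+ 2 1 (count U) ⟩
      2 + 2 * count U        <⟨ +-monoʳ-< 2 deficient ⟩
      2 + fixed N            ≤⟨ same-parity-gap {a = proj₁ pN} {proj₁ pM} (trans (sym (proj₂ pN)) (proj₂ pM)) more ⟩
      fixed M                ∎
      where
      open ≤-Reasoning
      pN = all-fixed-parity N
      pM = all-fixed-parity M
      fixesU : Fixes U M
      fixesU w Uw = fixes w (cong (_∨ w == v) Uw)
      Mv : mate M v ≡ v
      Mv = fixes v (trans (cong (U v ∨_) (==-refl v)) (∨-zeroʳ (U v)))
      more : fixed N < fixed M
      more with fixed M ≤? fixed N
      ... | yes p = ⊥-elim (moved M (fixesU , λ M′ f → ≤-trans p (proj₂ optN M′ f)) Mv)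
      ... | no p = ≰⇒> p

  -- Induction on the number `k` of vertices outside `U`. A vertex covered by all optimal matchings
  -- is moved into `U`, preserving the deficiency; when there is none, `Saturated` applies.
  no-barrier : ∀ k U → n ≡ count U + k → ¬ (∀ N → Fixes U N → 2 * count U < fixed N)
  no-barrier k U size deficient = optimal-exists U λ (N , optN) → ¬¬-excluded-middle (split N optN)
    where
    Unavoidable : Set
    Unavoidable = Σ (Fin n) λ v → U v ≡ false × (∀ M → Optimal U M → mate M v ≢ v)
    grow : ∀ k → n ≡ count U + k → ∀ N → Optimal U N → Unavoidable → ⊥
    split : ∀ N → Optimal U N → Dec Unavoidable → ⊥
    split N optN (yes un) = grow k size N optN un
    split N optN (no avoidable) =
      -- The goal is `⊥`, so matchings missing each vertex may be chosen and `Linked` taken to be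
      -- decidable.
      ¬¬-∀ missed λ missed′ → ¬¬-∀ (λ u → ¬¬-∀ λ v → ¬¬-excluded-middle) λ linked? →
        Saturated.absurd U N optN (deficient N (proj₁ optN)) missed′ linked?
      where
      missed : ∀ v → ¬ ¬ (U v ≡ false → Σ (Matching G) λ M → Optimal U M × mate M v ≡ v)
      missed v none = ¬¬-excluded-middle λ
        { (yes Uv) → avoidable (v , Uv , λ M opt p → none λ _ → M , opt , p)
        ; (no Uv) → none λ Uv′ → ⊥-elim (Uv Uv′) }
    grow zero size N optN (v , Uv , moved) =
      <-irrefl (trans (sym (+-identityʳ _)) (sym size)) (count<size U v Uv)
    grow (suc k) size N optN (v , Uv , moved) =
      no-barrier k _ (trans size (trans (+-suc (count U) k) (cong (_+ k) (sym (proj₁ next))))) (proj₂ next)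
      where next = extend-barrier U N optN (deficient N (proj₁ optN)) v Uv moved

-- Three-edge cuts from small cuts or from the lack of a perfect matching

pad : ∀ {m} (p : Subset m) k → ∣ p ∣ ≤ k → k ≤ m →
  Σ (Subset m) λ q → ∣ q ∣ ≡ k × (∀ e → lookup p e ≡ true → lookup q e ≡ true)
pad [] zero _ _ = [] , refl , λ ()
pad (true ∷ p) (suc k) (s≤s lo) (s≤s hi) with pad p k lo hi
... | q , size , sup = true ∷ q , cong suc size , λ { zero _ → refl ; (suc e) → sup e }
pad {suc m} (false ∷ p) k lo hi with k ≤? m
... | yes hi′ with pad p k lo hi′
...   | q , size , sup = false ∷ q , size , λ { (suc e) → sup e }
-- Here `k` equals `suc m`, so every element has to be taken, including the first.
pad {suc m} (false ∷ p) k lo hi | no k≰m with pad p m (∣p∣≤n p) ≤-refl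
...   | q , size , sup = true ∷ q , trans (cong suc size) (≤-antisym (≰⇒> k≰m) hi) , λ { (suc e) → sup e }

-- A cut remains a cut when edges are added, so one of size 1 can be padded to three edges.
small-cut⇒3-cut : ∀ {n m} (G : Graph n m) (C : Fin n → Bool) {k} → count (cross G C) ≡ suc k → k ≤ 2 → 3 ≤ m →
  Σ (Subset m) λ S → EdgeCut G S × ∣ S ∣ ≡ 3
small-cut⇒3-cut {n} {m} G C {k} size k≤2 m≥3 = proj₁ padded , closed-set⇒cut closed , proj₁ (proj₂ padded)
  where
  δ : Subset m
  δ = tabulate (cross G C)
  ∣δ∣ : ∣ δ ∣ ≡ suc k
  ∣δ∣ = trans (∣∣≡count δ) (trans (count-cong (lookup∘tabulate (cross G C))) size)
  padded = pad δ 3 (≤-trans (≤-reflexive ∣δ∣) (s≤s k≤2)) m≥3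
  crossing : Σ (Fin m) λ e → ⟦ cross G C e ⟧ ≢ 0
  crossing = nonzero-term (λ e → ⟦ cross G C e ⟧) size
  ⟦⟧-true : ∀ {b} → ⟦ b ⟧ ≢ 0 → b ≡ true
  ⟦⟧-true {true} _ = refl
  ⟦⟧-true {false} p = ⊥-elim (p refl)
  closed : ClosedSet G (proj₁ padded)
  closed with crossing-joins G C (proj₁ crossing) (⟦⟧-true (proj₂ crossing))
  ... | u , v , Cu , Cv , _ = record
    { X = C ; x = u ; Xx = Cu ; y = v ; Xy = Cv
    ; δ⊆S = λ e ce → lookup⇒[]= e _ (proj₂ (proj₂ padded) e (trans (lookup∘tabulate (cross G C) e) ce)) }

-- A finite search over vertex sets decides whether a cut of size 1 or 3 exists. If none does, all
-- odd cuts have size at least 5, and the barrier argument starts from the empty set.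
3-cut-exists : ∀ {n m} (G : Graph n m) → 1 ≤ n → Regular 5 G → ¬ Has41Coloring G →
  Σ (Subset m) λ S → EdgeCut G S × ∣ S ∣ ≡ 3
3-cut-exists {n} {m} G n≥1 reg uncolourable
  with anySubset? (λ C → (count (cross G (lookup C)) ℕ.≟ 1) ⊎-dec (count (cross G (lookup C)) ℕ.≟ 3))
... | yes (C , inj₁ p) = small-cut⇒3-cut G (lookup C) p z≤n (edges≥3 G reg n≥1)
... | yes (C , inj₂ p) = small-cut⇒3-cut G (lookup C) p ≤-refl (edges≥3 G reg n≥1)
... | no none = ⊥-elim (Barrier.no-barrier G reg odd≥5 n (λ _ → false) (cong (_+ n) (sym (sum-0 n))) deficient)
  where
  not-size : ∀ {k} (C : Fin n → Bool) → (∀ (C : Subset n) → count (cross G (lookup C)) ≢ k) → count (cross G C) ≢ k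
  not-size C h p = h (tabulate C) (trans (count-cong (cross-cong G (lookup∘tabulate C))) p)
  odd≥5 : ∀ C k → count C ≡ 1 + 2 * k → 5 ≤ count (cross G C)
  odd≥5 C k odd = odd-cut≥5 G reg C k odd
    (not-size C λ C p → none (C , inj₁ p)) (not-size C λ C p → none (C , inj₂ p))
  -- For empty `U`, deficiency says that no matching is perfect, since a perfect one would colour
  -- `G`.
  deficient : ∀ N → Fixes {G = G} (λ _ → false) N → 2 * count {n} (λ _ → false) < fixed N
  deficient N _ rewrite sum-0 n with fixed N in p
  ... | zero = ⊥-elim (uncolourable (perfect-matching-colours G reg N p n≥1))
  ... | suc _ = s≤s z≤n

theorem5 : ∀ {n m} (G : Graph n m) → MinimalCounterexample G →
    Connected G
    × (Σ (Subset m) λ S → EdgeCut G S × ∣ S ∣ ≡ 3)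
    × (¬ (Σ (Subset m) λ S → MinimalEdgeCut G S × ∣ S ∣ ≡ 2))
    × (∀ e e' → Bridge G e → Bridge G e' → e ≡ e')
    × (∀ e → Bridge G e →
    (loops G (proj₁ (ends G e)) ≡ 2 × loops G (proj₂ (ends G e)) ≢ 2)
    ⊎ (loops G (proj₁ (ends G e)) ≢ 2 × loops G (proj₂ (ends G e)) ≡ 2))
    × (∀ S → MinimalEdgeCut G S → ∣ S ∣ ≡ 3 →
    Σ (Fin n) λ w → (∀ e → e ∈ S → EndOf G e w) × 1 ≤ loops G w)
theorem5 G mc@(n≥1 , reg , uncolourable , _) =
  connected ,
  3-cut-exists G n≥1 reg uncolourable ,
  (λ (S , minimal , size-2) → no-minimal-2-cut S minimal size-2) ,
  bridges-equal ,
  bridge-ends ,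
  three-cut-at-vertex
  where open Reductions G mc
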